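{- Let $M$ be a term of the CCV $\lambda\mu$-calculus. The call-by-value evaluation of $M$ terminates if and only if the CPS translation $[\![M]\!]$ is solvable (as an untyped $\lambda$-term, i.e., it is $\beta$-convertible to a head normal form).
   Context: CCV $\lambda\mu$-calculus syntax. Ordinary variables $x,y,z,\dots$ and continuation variables $k,l,m,\dots$ are disjoint. Terms $M ::= x \mid \lambda x.M \mid MM \mid (M\ \mathsf{where}\ x:=M) \mid \mu k.J$, jumps $J ::= [k]M \mid (J\ \mathsf{where}\ x:=M)$, where $(L\ \mathsf{where}\ x:=M)$ means $\mathsf{let}\ x=M\ \mathsf{in}\ L$ ($x$ bound in $L$ only); $\lambda x$ and $\mu k$ bind as usual. Values $V$ are variables and $\lambda$-abstractions. For the operational semantics, terms are syntax trees up to $\alpha$-conversion only, except that $[k](L\ \mathsf{where}\ x:=M)$ and $([k]L\ \mathsf{where}\ x:=M)$ are identified and read as $[k](L\ \mathsf{where}\ x:=M)$; in particular $((\mu k.J)\ \mathsf{where}\ x:=M)$ is distinguished from $\mu k.(J\ \mathsf{where}\ x:=M)$, and $((L\ \mathsf{where}\ x:=M)\ \mathsf{where}\ y:=N)$ from $(L\ \mathsf{where}\ x:=(M\ \mathsf{where}\ y:=N))$. Context substitution $J\{[k]\square\mapsto[k](M\ \mathsf{where}\ x:=\square)\}$ replaces recursively each subjump $[k]Q$ of $J$ with $k$ free by $[k](M\ \mathsf{where}\ x:=Q)$ (capture-avoiding); $J\{l/m\}$ replaces each such $[m]Q$ by $[l]Q$. Evaluation contexts: $E ::= \square \mid E[V\square]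 \mid E[\square M] \mid E[(M\ \mathsf{where}\ x:=\square)]$. $E_0$-rewriting ($z$ fresh): $E[(\mu k.J)M]\to E[(zM\ \mathsf{where}\ z:=\mu k.J)]$; $E[V(\mu k.J)]\to E[(Vz\ \mathsf{where}\ z:=\mu k.J)]$; $E[(\lambda x.M)V]\to E[(M\ \mathsf{where}\ x:=V)]$; $E[(M\ \mathsf{where}\ x:=V)]\to E[M\{V/x\}]$; $E[(M\ \mathsf{where}\ x:=\mu k.J)]\to E[\mu k.J\{[k]\square\mapsto[k](M\ \mathsf{where}\ x:=\square)\}]$. $E$-rewriting $\to_E$ is given by: $\mu k.[l]\mu m.J\to_E\mu k.J\{l/m\}$; if $L\to_{E_0}M$ then $L\to_E M$; if $L\to_{E_0}M$ then $\mu k.[l]L\to_E\mu k.[l]M$. A term is $E$-normal if no $E$-rewriting applies to it. The call-by-value evaluation of $M$ terminates if $M\to_E^* N$ for some $E$-normal $N$. Target calculus: sorted $\lambda$-calculus $T::=\lambda k.Q\mid WW$, $Q::=KW\mid TK$, $W::=x\mid\lambda x.T$, $K::=k\mid\lambda x.Q$. CPS translation ($N$ a non-value, fresh bound variables): $\langle V\rangle[K]=KV^*$; $\langle V_1V_2\rangle[K]=V_1^*V_2^*K$; $\langle VN\rangle[K]=\langle N\rangle[\lambda y.V^*yK]$; $\langle NV\rangle[K]=\langle N\rangle[\lambda x.xV^*K]$; $\langle N_1N_2\rangle[K]=\langle N_1\rangle[\lambda x.\langle N_2\rangle[\lambda y.xyK]]$; $\langle (L\ \mathsf{where}\ x:=M)\rangle[K]=\langle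 M\rangle[\lambda x.\langle L\rangle[K]]$ (renaming $x$ if free in $K$); $\langle\mu k.J\rangle[K]=(\lambda k.\langle J\rangle)K$; $\langle[k]M\rangle=\langle M\rangle[k]$; $\langle (J\ \mathsf{where}\ x:=M)\rangle=\langle M\rangle[\lambda x.\langle J\rangle]$; $x^*=x$; $(\lambda x.M)^*=\lambda xk.\langle M\rangle[k]$; $[\![M]\!]=\lambda k.\langle M\rangle[k]$. -}

module Defs where

open import Data.Fin using (Fin; zero; suc)
open import Data.List using (List; []; _∷_; length)
open import Data.List.Membership.Propositional using (_∈_)
open import Data.List.Relation.Binary.Subset.Propositional using (_⊆_)
open import Data.List.Relation.Binary.Subset.Propositional.Properties using (∷⁺ʳ)
open import Data.List.Relation.Unary.Any using (here; there; index)
open import Data.Nat using (ℕ; suc)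
open import Data.Product using (∃-syntax; _×_)
open import Function using (_∘_)
open import Relation.Binary.Construct.Closure.Equivalence using (EqClosure)
open import Relation.Binary.Construct.Closure.ReflexiveTransitive using (Star)
open import Relation.Binary.PropositionalEquality using (_≡_; refl; cong)
open import Relation.Nullary using (¬_; Dec; yes; no)
open import Relation.Nullary.Decidable using (map′)

-- Terms up to α-conversion are well-scoped de Bruijn terms.  One context
-- lists the ordinary and the continuation variables in scope, so
-- `ord ∈ Γ` are the variables x, y, z, … and `cont ∈ Γ` are k, l, m, ….

data Kind : Set where
  ord cont : Kind

Ctx : Set
Ctx = List Kind

pattern Z   = here refl
pattern S x = there x

private variable
  Γ Δ : Ctx
  s : Kind

ext : Γ ⊆ Δ → (s ∷ Γ) ⊆ (s ∷ Δ)
ext ρ = ∷⁺ʳ _ ρ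

_≟ᵛ_ : (x y : s ∈ Γ) → Dec (x ≡ y)
Z   ≟ᵛ Z   = yes refl
Z   ≟ᵛ S _ = no λ ()
S _ ≟ᵛ Z   = no λ ()
S x ≟ᵛ S y = map′ (cong there) (λ { refl → refl }) (x ≟ᵛ y)

-- `full` is the whole grammar.  In the operational semantics
-- [k](L where x:=M) and ([k]L where x:=M) are one and the same jump, read
-- as the former; `merged` is the set of representatives so obtained, in
-- which every jump has the shape [k]M.

data Form : Set where
  full merged : Form

private variable
  f : Form

infixl 7 _·_
infix  6 [_]_
infixl 5 _where≔_ _whereJ≔_

mutual
  data Term : Form → Ctx → Set where
    var      : ord ∈ Γ → Term f Γ
    ƛ        : Term f (ord ∷ Γ) → Term f Γ
    _·_      : Term f Γ → Term f Γ → Term f Γ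
    _where≔_ : Term f (ord ∷ Γ) → Term f Γ → Term f Γ
    μ        : Jump f (cont ∷ Γ) → Term f Γ

  data Jump : Form → Ctx → Set where
    [_]_      : cont ∈ Γ → Term f Γ → Jump f Γ
    _whereJ≔_ : Jump full (ord ∷ Γ) → Term full Γ → Jump full Γ

data Value : Term f Γ → Set where
  var : (x : ord ∈ Γ) → Value {f} (var x)
  ƛ   : (M : Term f (ord ∷ Γ)) → Value (ƛ M)

value? : (M : Term f Γ) → Dec (Value M)
value? (var x)      = yes (var x)
value? (ƛ M)        = yes (ƛ M)
value? (_ · _)      = no λ ()
value? (_ where≔ _) = no λ ()
value? (μ _)        = no λ ()

pushWhere : Jump merged (ord ∷ Γ) → Term merged Γ → Jump merged Γ
pushWhere ([ S k ] L) M = [ k ] (L where≔ M)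

mutual
  merge : Term f Γ → Term merged Γ
  merge (var x)      = var x
  merge (ƛ M)        = ƛ (merge M)
  merge (M · N)      = merge M · merge N
  merge (L where≔ M) = merge L where≔ merge M
  merge (μ J)        = μ (mergeJ J)

  mergeJ : Jump f Γ → Jump merged Γ
  mergeJ ([ k ] M)     = [ k ] merge M
  mergeJ (J whereJ≔ M) = pushWhere (mergeJ J) (merge M)

mutual
  ren : Γ ⊆ Δ → Term f Γ → Term f Δ
  ren ρ (var x)      = var (ρ x)
  ren ρ (ƛ M)        = ƛ (ren (ext ρ) M)
  ren ρ (M · N)      = ren ρ M · ren ρ N
  ren ρ (L where≔ M) = ren (ext ρ) L where≔ ren ρ M
  ren ρ (μ J)        = μ (renJ (ext ρ) J)

  renJ : Γ ⊆ Δ → Jump f Γ → Jump f Δ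
  renJ ρ ([ k ] M)     = [ ρ k ] ren ρ M
  renJ ρ (J whereJ≔ M) = renJ (ext ρ) J whereJ≔ ren ρ M

wk : Term f Γ → Term f (s ∷ Γ)
wk = ren there

record Sub (f : Form) (Γ Δ : Ctx) : Set where
  constructor sub
  field
    tm : ord ∈ Γ → Term f Δ
    kv : cont ∈ Γ → cont ∈ Δ

extSub : Sub f Γ Δ → Sub f (s ∷ Γ) (s ∷ Δ)
extSub {f} {Γ} {Δ} {s} (sub tm kv) = sub tm′ kv′
  where
  tm′ : ord ∈ (s ∷ Γ) → Term f (s ∷ Δ)
  tm′ Z     = var Z
  tm′ (S x) = wk (tm x)
  kv′ : cont ∈ (s ∷ Γ) → cont ∈ (s ∷ Δ)
  kv′ Z     = Z
  kv′ (S k) = S (kv k)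

mutual
  subst : Sub f Γ Δ → Term f Γ → Term f Δ
  subst σ (var x)      = Sub.tm σ x
  subst σ (ƛ M)        = ƛ (subst (extSub σ) M)
  subst σ (M · N)      = subst σ M · subst σ N
  subst σ (L where≔ M) = subst (extSub σ) L where≔ subst σ M
  subst σ (μ J)        = μ (substJ (extSub σ) J)

  substJ : Sub f Γ Δ → Jump f Γ → Jump f Δ
  substJ σ ([ k ] M)     = [ Sub.kv σ k ] subst σ M
  substJ σ (J whereJ≔ M) = substJ (extSub σ) J whereJ≔ subst σ M

-- M {V/x}, where x is the most recently bound variable of M.

_[_/x] : Term f (ord ∷ Γ) → Term f Γ → Term f Γ
_[_/x] {f} {Γ} M V = subst (sub tm kv) M
  where
  tm : ord ∈ (ord ∷ Γ) → Term f Γ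
  tm Z     = V
  tm (S x) = var x
  kv : cont ∈ (ord ∷ Γ) → cont ∈ Γ
  kv (S k) = k

-- J {l/m}, where m is the most recently bound variable of J.  Since
-- continuation variables occur only as labels of jumps, this is a renaming.

_[_/k] : Jump f (cont ∷ Γ) → cont ∈ Γ → Jump f Γ
_[_/k] {Γ = Γ} J l = renJ ρ J
  where
  ρ : (cont ∷ Γ) ⊆ Γ
  ρ Z     = l
  ρ (S x) = x

-- {[k]□ ↦ [k](M where x:=□)}

mutual
  ctxSub : cont ∈ Γ → Term merged (ord ∷ Γ) → Term merged Γ → Term merged Γ
  ctxSub k M (var x)      = var x
  ctxSub k M (ƛ L)        = ƛ (ctxSub (S k) (ren (ext there) M) L)
  ctxSub k M (L · N)      = ctxSub k M L · ctxSub k M N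
  ctxSub k M (L where≔ N) =
    ctxSub (S k) (ren (ext there) M) L where≔ ctxSub k M N
  ctxSub k M (μ J)        = μ (ctxSubJ (S k) (ren (ext there) M) J)

  ctxSubJ : cont ∈ Γ → Term merged (ord ∷ Γ) → Jump merged Γ → Jump merged Γ
  ctxSubJ k M ([ l ] Q) with l ≟ᵛ k
  ... | yes _ = [ k ] (M where≔ ctxSub k M Q)
  ... | no  _ = [ l ] ctxSub k M Q

-- The constructors extend a context at its hole: E[V□], E[□M],
-- E[(M where x:=□)].

data EvalCtx (Γ : Ctx) : Set where
  □        : EvalCtx Γ
  _[_·□]   : EvalCtx Γ → {V : Term merged Γ} → Value V → EvalCtx Γ
  _[□·_]   : EvalCtx Γ → Term merged Γ → EvalCtx Γ
  _[_≔□]   : EvalCtx Γ → Term merged (ord ∷ Γ) → EvalCtx Γ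

_⟦_⟧ : EvalCtx Γ → Term merged Γ → Term merged Γ
□                 ⟦ L ⟧ = L
(_[_·□] E {V} v) ⟦ L ⟧ = E ⟦ V · L ⟧
(E [□· M ])       ⟦ L ⟧ = E ⟦ L · M ⟧
(E [ M ≔□])       ⟦ L ⟧ = E ⟦ M where≔ L ⟧

infix 4 _→E₀_ _→E_ _→E*_

data _→E₀_ {Γ : Ctx} : Term merged Γ → Term merged Γ → Set where
  μ-fun : ∀ E J M →
    E ⟦ μ J · M ⟧ →E₀ E ⟦ (var Z · wk M) where≔ μ J ⟧
  μ-arg : ∀ E {V} → Value V → ∀ J →
    E ⟦ V · μ J ⟧ →E₀ E ⟦ (wk V · var Z) where≔ μ J ⟧
  β-lam : ∀ E M {V} → Value V →
    E ⟦ ƛ M · V ⟧ →E₀ E ⟦ M where≔ V ⟧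
  β-val : ∀ E M {V} → Value V →
    E ⟦ M where≔ V ⟧ →E₀ E ⟦ M [ V /x] ⟧
  β-μ   : ∀ E M J →
    E ⟦ M where≔ μ J ⟧ →E₀ E ⟦ μ (ctxSubJ Z (ren (ext there) M) J) ⟧

data _→E_ {Γ : Ctx} : Term merged Γ → Term merged Γ → Set where
  μμ   : ∀ l J → μ ([ l ] μ J) →E μ (J [ l /k])
  top  : ∀ {L M} → L →E₀ M → L →E M
  jump : ∀ l {L M} → L →E₀ M → μ ([ l ] L) →E μ ([ l ] M)

_→E*_ : Term merged Γ → Term merged Γ → Set
_→E*_ = Star _→E_

ENormal : Term merged Γ → Set
ENormal M = ¬ (∃[ N ] M →E N)

Terminates : Term full Γ → Set
Terminates M = ∃[ N ] (merge M →E* N × ENormal N)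

data Sort : Set where
  T Q W K : Sort

infixl 7 _·ww_ _·kw_ _·tk_

data Target : Sort → Ctx → Set where
  ƛk    : Target Q (cont ∷ Γ) → Target T Γ
  _·ww_ : Target W Γ → Target W Γ → Target T Γ
  _·kw_ : Target K Γ → Target W Γ → Target Q Γ
  _·tk_ : Target T Γ → Target K Γ → Target Q Γ
  wvar  : ord ∈ Γ → Target W Γ
  ƛw    : Target T (ord ∷ Γ) → Target W Γ
  kvar  : cont ∈ Γ → Target K Γ
  ƛq    : Target Q (ord ∷ Γ) → Target K Γ

private variable
  u : Sort

renT : Γ ⊆ Δ → Target u Γ → Target u Δ
renT ρ (ƛk A)    = ƛk (renT (ext ρ) A)
renT ρ (A ·ww B) = renT ρ A ·ww renT ρ B
renT ρ (A ·kw B) = renT ρ A ·kw renT ρ B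
renT ρ (A ·tk B) = renT ρ A ·tk renT ρ B
renT ρ (wvar x)  = wvar (ρ x)
renT ρ (ƛw A)    = ƛw (renT (ext ρ) A)
renT ρ (kvar k)  = kvar (ρ k)
renT ρ (ƛq A)    = ƛq (renT (ext ρ) A)

wkT : Target u Γ → Target u (s ∷ Γ)
wkT = renT there

-- cps M ρ C is ⟨M⟩[C] with the free variables of M renamed along ρ.  The
-- renaming carries M under the administrative binders of the target while
-- keeping the recursion structural.

mutual
  cps : Term f Γ → Γ ⊆ Δ → Target K Δ → Target Q Δ
  cps V@(var x) ρ C = C ·kw star V (var x) ρ
  cps V@(ƛ M)   ρ C = C ·kw star V (ƛ M) ρ
  cps (M · N)   ρ C with value? M | value? N
  ... | yes v | yes w = (star M v ρ ·ww star N w ρ) ·tk C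
  ... | yes v | no _  =
    cps N ρ (ƛq ((star M v (there ∘ ρ) ·ww wvar Z) ·tk wkT C))
  ... | no _  | yes w =
    cps M ρ (ƛq ((wvar Z ·ww star N w (there ∘ ρ)) ·tk wkT C))
  ... | no _  | no _  =
    cps M ρ (ƛq (cps N (there ∘ ρ)
      (ƛq ((wvar (S Z) ·ww wvar Z) ·tk wkT (wkT C)))))
  cps (L where≔ M) ρ C = cps M ρ (ƛq (cps L (ext ρ) (wkT C)))
  cps (μ J)        ρ C = ƛk (cpsJ J (ext ρ)) ·tk C

  cpsJ : Jump f Γ → Γ ⊆ Δ → Target Q Δ
  cpsJ ([ k ] M)     ρ = cps M ρ (kvar (ρ k))
  cpsJ (J whereJ≔ M) ρ = cps M ρ (ƛq (cpsJ J (ext ρ)))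

  star : (V : Term f Γ) → Value V → Γ ⊆ Δ → Target W Δ
  star (var x) _ ρ = wvar (ρ x)
  star (ƛ M)   _ ρ = ƛw (ƛk (cps M (there ∘ ext ρ) (kvar Z)))

CPS⟦_⟧ : Term f Γ → Target T Γ
CPS⟦ M ⟧ = ƛk (cps M there (kvar Z))

data Λ (n : ℕ) : Set where
  var : Fin n → Λ n
  lam : Λ (suc n) → Λ n
  app : Λ n → Λ n → Λ n

private variable
  n p : ℕ

extΛ : (Fin n → Fin p) → Fin (suc n) → Fin (suc p)
extΛ ρ zero    = zero
extΛ ρ (suc i) = suc (ρ i)

renΛ : (Fin n → Fin p) → Λ n → Λ p
renΛ ρ (var i)   = var (ρ i)
renΛ ρ (lam A)   = lam (renΛ (extΛ ρ) A)
renΛ ρ (app A B) = app (renΛ ρ A) (renΛ ρ B)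

extsΛ : (Fin n → Λ p) → Fin (suc n) → Λ (suc p)
extsΛ σ zero    = var zero
extsΛ σ (suc i) = renΛ suc (σ i)

substΛ : (Fin n → Λ p) → Λ n → Λ p
substΛ σ (var i)   = σ i
substΛ σ (lam A)   = lam (substΛ (extsΛ σ) A)
substΛ σ (app A B) = app (substΛ σ A) (substΛ σ B)

_[_]Λ : Λ (suc n) → Λ n → Λ n
_[_]Λ {n} A B = substΛ σ A
  where
  σ : Fin (suc n) → Λ n
  σ zero    = B
  σ (suc i) = var i

infix 4 _→β_ _=β_

data _→β_ {n : ℕ} : Λ n → Λ n → Set where
  β    : ∀ A B → app (lam A) B →β A [ B ]Λ
  lam  : ∀ {A A′} → A →β A′ → lam A →β lam A′
  appˡ : ∀ {A A′ B} → A →β A′ → app A B →β app A′ B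
  appʳ : ∀ {A B B′} → B →β B′ → app A B →β app A B′

_=β_ : Λ n → Λ n → Set
_=β_ = EqClosure _→β_

-- Head normal forms λx₁…xᵢ. y A₁ … Aⱼ.

data VarHeaded {n : ℕ} : Λ n → Set where
  var : ∀ i → VarHeaded (var i)
  app : ∀ {A} → VarHeaded A → ∀ B → VarHeaded (app A B)

data HNF {n : ℕ} : Λ n → Set where
  head : ∀ {A} → VarHeaded A → HNF A
  lam  : ∀ {A} → HNF A → HNF (lam A)

Solvable : Λ n → Set
Solvable A = ∃[ B ] (A =β B × HNF B)

erase : Target u Γ → Λ (length Γ)
erase (ƛk A)    = lam (erase A)
erase (A ·ww B) = app (erase A) (erase B)
erase (A ·kw B) = app (erase A) (erase B)
erase (A ·tk B) = app (erase A) (erase B)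
erase (wvar x)  = var (index x)
erase (ƛw A)    = lam (erase A)
erase (kvar k)  = var (index k)
erase (ƛq A)    = lam (erase A)

{-# OPTIONS --safe #-}
module Submission where

-- Up to administrative steps, E-rewriting of M is weak head reduction of
-- ⟨M⟩[k], and the translation of an E-normal term weak head reduces to a
-- variable-headed term.  The translations of the two sides of an E₀-step have
-- a common weak head reduct, nearer to the right-hand side except for the
-- μ-steps, which instead shrink the evaluation context.  So termination of
-- weak head reduction of ⟨M⟩[k] forces termination of E-rewriting.
-- That solvability of λk.⟨M⟩[k] yields termination of weak head reduction is
-- shown without confluence or standardisation: the interpretation in a graph
-- model is invariant under β-conversion and inhabited for head normal forms,
-- and a reducibility argument shows that inhabited terms terminate.

open import Defs
open import Data.Empty using (⊥)
open import Data.Fin using (Fin; zero; suc)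
open import Data.Fin.Properties using (_≟_)
open import Data.List using (List; []; _∷_; _++_; length)
open import Data.List.Membership.Propositional using (_∈_)
open import Data.List.Membership.Propositional.Properties using (∈-++⁺ˡ; ∈-++⁺ʳ)
open import Data.List.Relation.Binary.Subset.Propositional using (_⊆_)
open import Data.List.Relation.Unary.All as All using (All; []; _∷_)
open import Data.List.Relation.Unary.All.Properties using (++⁺)
open import Data.List.Relation.Unary.Any using (here; there; index)
open import Data.Nat using (ℕ; suc; _+_; _≤_; _<_; z≤n; s≤s)
open import Data.Nat.Induction using (<-wellFounded)
open import Data.Nat.Properties using (≤-refl; +-monoˡ-<; +-monoʳ-<; +-monoˡ-≤; n<1+n)
open import Data.Product using (Σ-syntax; ∃-syntax; _×_; _,_; proj₂)
open import Data.Product.Relation.Binary.Lex.Strict using (×-Lex; ×-wellFounded)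
open import Data.Sum using (_⊎_; inj₁; inj₂)
open import Data.Unit using (⊤; tt)
open import Function using (_∘_; id)
open import Function.Bundles using (_⇔_; mk⇔; Equivalence)
open import Function.Construct.Identity using (⇔-id)
open import Induction.WellFounded using (Acc; acc; WellFounded)
import Relation.Binary.Construct.Closure.Equivalence as Eq
open import Relation.Binary.Construct.Closure.ReflexiveTransitive using (ε; _◅_; _◅◅_)
open import Relation.Binary.Construct.Closure.Symmetric using (fwd; bwd)
open import Relation.Binary.PropositionalEquality
  using (_≡_; _≢_; refl; sym; trans; cong; cong₂) renaming (subst to transport)
open import Relation.Nullary using (¬_; Dec; yes; no; contradiction)

private variable
  n p q : ℕ
  Γ Δ : Ctx
  s : Kind

-- Substitution in the untyped λ-calculus

-- The composite is a third map, equal only pointwise, here and in the fusion lemmas below, so that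
-- the induction passes under `lam` without function extensionality.
ren-ren : {ρ₁ : Fin n → Fin p} {ρ₂ : Fin p → Fin q} {ρ₃ : Fin n → Fin q} →
  (∀ i → ρ₂ (ρ₁ i) ≡ ρ₃ i) → ∀ A → renΛ ρ₂ (renΛ ρ₁ A) ≡ renΛ ρ₃ A
ren-ren h (var i)   = cong var (h i)
ren-ren h (lam A)   = cong lam (ren-ren (λ { zero → refl ; (suc i) → cong suc (h i) }) A)
ren-ren h (app A B) = cong₂ app (ren-ren h A) (ren-ren h B)

ren-as-subst : {ρ : Fin n → Fin p} {σ : Fin n → Λ p} →
  (∀ i → var (ρ i) ≡ σ i) → ∀ A → renΛ ρ A ≡ substΛ σ A
ren-as-subst h (var i)   = h i
ren-as-subst h (lam A)   =
  cong lam (ren-as-subst (λ { zero → refl ; (suc i) → cong (renΛ suc) (h i) }) A)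
ren-as-subst h (app A B) = cong₂ app (ren-as-subst h A) (ren-as-subst h B)

subst-ren : {ρ : Fin n → Fin p} {σ : Fin p → Λ q} {τ : Fin n → Λ q} →
  (∀ i → σ (ρ i) ≡ τ i) → ∀ A → substΛ σ (renΛ ρ A) ≡ substΛ τ A
subst-ren h (var i)   = h i
subst-ren h (lam A)   =
  cong lam (subst-ren (λ { zero → refl ; (suc i) → cong (renΛ suc) (h i) }) A)
subst-ren h (app A B) = cong₂ app (subst-ren h A) (subst-ren h B)

ren-wk : (ρ : Fin n → Fin p) → ∀ A → renΛ (extΛ ρ) (renΛ suc A) ≡ renΛ suc (renΛ ρ A)
ren-wk ρ A = trans (ren-ren (λ _ → refl) A) (sym (ren-ren (λ _ → refl) A))

ren-subst : {σ : Fin n → Λ p} {ρ : Fin p → Fin q} {τ : Fin n → Λ q} →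
  (∀ i → renΛ ρ (σ i) ≡ τ i) → ∀ A → renΛ ρ (substΛ σ A) ≡ substΛ τ A
ren-subst h (var i)   = h i
ren-subst {σ = σ} {ρ} h (lam A) =
  cong lam (ren-subst (λ { zero → refl
                         ; (suc i) → trans (ren-wk ρ (σ i)) (cong (renΛ suc) (h i)) }) A)
ren-subst h (app A B) = cong₂ app (ren-subst h A) (ren-subst h B)

subst-wk : (σ : Fin n → Λ p) → ∀ A → substΛ (extsΛ σ) (renΛ suc A) ≡ renΛ suc (substΛ σ A)
subst-wk σ A = trans (subst-ren (λ _ → refl) A) (sym (ren-subst (λ _ → refl) A))

subst-subst : {σ : Fin n → Λ p} {τ : Fin p → Λ q} {υ : Fin n → Λ q} →
  (∀ i → substΛ τ (σ i) ≡ υ i) → ∀ A → substΛ τ (substΛ σ A) ≡ substΛ υ A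
subst-subst h (var i)   = h i
subst-subst {σ = σ} {τ} h (lam A) =
  cong lam (subst-subst (λ { zero → refl
                           ; (suc i) → trans (subst-wk τ (σ i)) (cong (renΛ suc) (h i)) }) A)
subst-subst h (app A B) = cong₂ app (subst-subst h A) (subst-subst h B)

subst-id : {σ : Fin n → Λ n} → (∀ i → σ i ≡ var i) → ∀ A → substΛ σ A ≡ A
subst-id h (var i)   = h i
subst-id h (lam A)   =
  cong lam (subst-id (λ { zero → refl ; (suc i) → cong (renΛ suc) (h i) }) A)
subst-id h (app A B) = cong₂ app (subst-id h A) (subst-id h B)

infixr 5 _∷ˢ_
_∷ˢ_ : Λ p → (Fin n → Λ p) → Fin (suc n) → Λ p
(B ∷ˢ σ) zero    = B
(B ∷ˢ σ) (suc i) = σ i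

-- The substitution inside `_[_]Λ` is local to that definition and only pointwise equal to
-- `B ∷ˢ var`; composing with the identity substitution turns the pointwise equality into an
-- equality of terms.
[]Λ-subst : ∀ (A : Λ (suc n)) B → A [ B ]Λ ≡ substΛ (B ∷ˢ var) A
[]Λ-subst A B =
  trans (sym (subst-id (λ _ → refl) _))
    (subst-subst (λ { zero → subst-id (λ _ → refl) B ; (suc i) → refl }) A)

subst-single-wk : ∀ (A B : Λ n) → substΛ (B ∷ˢ var) (renΛ suc A) ≡ A
subst-single-wk A B = trans (subst-ren (λ _ → refl) A) (subst-id (λ _ → refl) A)

subst-exts-single : (σ : Fin n → Λ p) → ∀ A B →
  substΛ (extsΛ σ) A [ B ]Λ ≡ substΛ (B ∷ˢ σ) A
subst-exts-single σ A B = trans ([]Λ-subst (substΛ (extsΛ σ) A) B)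
  (subst-subst {σ = extsΛ σ} {τ = B ∷ˢ var} (λ { zero → refl ; (suc i) → subst-single-wk (σ i) B }) A)

-- Weak head reduction

infix 4 _→w_

data _→w_ {n} : Λ n → Λ n → Set where
  β    : ∀ A B → app (lam A) B →w A [ B ]Λ
  appˡ : ∀ {A A′ B} → A →w A′ → app A B →w app A′ B

→w-deterministic : {A B C : Λ n} → A →w B → A →w C → B ≡ C
→w-deterministic (β A B)  (β .A .B) = refl
→w-deterministic (appˡ r) (appˡ r′) = cong (λ D → app D _) (→w-deterministic r r′)

→w? : (A : Λ n) → Dec (∃[ B ] A →w B)
→w? (var i)           = no λ ()
→w? (lam A)           = no λ ()
→w? (app (var i) B)   = no λ { (_ , appˡ ()) }
→w? (app (lam A) B)   = yes (_ , β A B)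
→w? (app A@(app _ _) B) with →w? A
... | yes (_ , r) = yes (_ , appˡ r)
... | no ¬r       = no λ { (_ , appˡ r) → ¬r (_ , r) }

VarHeaded-normal : {A B : Λ n} → VarHeaded A → ¬ (A →w B)
VarHeaded-normal (app h B) (appˡ r) = VarHeaded-normal h r

→w⇒→β : {A B : Λ n} → A →w B → A →β B
→w⇒→β (β A B)  = β A B
→w⇒→β (appˡ r) = appˡ (→w⇒→β r)

SN : Λ n → Set
SN = Acc (λ B A → A →w B)

data Steps {n} : ℕ → Λ n → Λ n → Set where
  done : ∀ {A} → Steps 0 A A
  step : ∀ {k A B C} → A →w B → Steps k B C → Steps (suc k) A C

-- The index is the exact length of the reduction to weak head normal form, the leading component of
-- the measure behind `evaluate`.
data Halts {n} : ℕ → Λ n → Set where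
  normal : ∀ {A} → ¬ (∃[ B ] A →w B) → Halts 0 A
  step   : ∀ {k A B} → A →w B → Halts k B → Halts (suc k) A

SN⇒Halts : {A : Λ n} → SN A → ∃[ k ] Halts k A
SN⇒Halts {A = A} (acc rs) with →w? A
... | no ¬r = 0 , normal ¬r
... | yes (_ , r) with SN⇒Halts (rs r)
... | k , h = suc k , step r h

Steps⇒=β : ∀ {k} {A B : Λ n} → Steps k A B → A =β B
Steps⇒=β done       = ε
Steps⇒=β (step r s) = fwd (→w⇒→β r) ◅ Steps⇒=β s

-- By determinism, every reduction sequence from `A` is an initial segment of the halting one, so
-- its length can be subtracted.
Halts-reduct : ∀ {i k} {A B : Λ n} → Steps i A B → Halts k A → ∃[ m ] (k ≡ i + m × Halts m B)
Halts-reduct done h = _ , refl , h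
Halts-reduct (step r s) (normal ¬r) = contradiction (_ , r) ¬r
Halts-reduct (step r s) (step r′ h) with →w-deterministic r r′
... | refl with Halts-reduct s h
... | m , refl , h′ = m , refl , h′

Halts-expand : ∀ {i m} {A B : Λ n} → Steps i A B → Halts m B → Halts (i + m) A
Halts-expand done       h = h
Halts-expand (step r s) h = step r (Halts-expand s h)

-- A graph model

infixr 6 _⇒_
-- Tokens can be read as intersection types: the source of `a ⇒ t` is the intersection of `a`, and
-- `[]` is the universal type.
data Token : Set where
  base : Token
  _⇒_  : List Token → Token → Token

Valuation : ℕ → Set₁
Valuation n = Fin n → Token → Set

infixr 5 _∷ᵛ_
_∷ᵛ_ : (Token → Set) → Valuation n → Valuation (suc n)
(X ∷ᵛ ρ) zero    = X
(X ∷ᵛ ρ) (suc i) = ρ i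

-- No abstraction has the token `base`, so every token of an abstraction is an arrow and yields a
-- token of its body.
⟦_⟧ᵍ : Λ n → Valuation n → Token → Set
⟦ var i ⟧ᵍ   ρ t       = ρ i t
⟦ lam A ⟧ᵍ   ρ base    = ⊥
⟦ lam A ⟧ᵍ   ρ (a ⇒ t) = ⟦ A ⟧ᵍ ((_∈ a) ∷ᵛ ρ) t
⟦ app A B ⟧ᵍ ρ t       = ∃[ a ] (⟦ A ⟧ᵍ ρ (a ⇒ t) × All (⟦ B ⟧ᵍ ρ) a)

graph-mono : {ρ ρ′ : Valuation n} → (∀ i {t} → ρ i t → ρ′ i t) →
  ∀ A {t} → ⟦ A ⟧ᵍ ρ t → ⟦ A ⟧ᵍ ρ′ t
graph-mono h (var i) x = h i x
graph-mono h (lam A) {a ⇒ t} x = graph-mono (λ { zero → id ; (suc i) → h i }) A x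
graph-mono h (app A B) (a , x , ys) = a , graph-mono h A x , All.map (graph-mono h B) ys

graph-ren⁻ : {r : Fin n → Fin p} {ρ : Valuation p} {ρ′ : Valuation n} →
  (∀ i {t} → ρ (r i) t → ρ′ i t) → ∀ A {t} → ⟦ renΛ r A ⟧ᵍ ρ t → ⟦ A ⟧ᵍ ρ′ t
graph-ren⁻ h (var i) x = h i x
graph-ren⁻ h (lam A) {a ⇒ t} x = graph-ren⁻ (λ { zero → id ; (suc i) → h i }) A x
graph-ren⁻ h (app A B) (a , x , ys) = a , graph-ren⁻ h A x , All.map (graph-ren⁻ h B) ys

graph-ren⁺ : {r : Fin n → Fin p} {ρ : Valuation p} {ρ′ : Valuation n} →
  (∀ i {t} → ρ′ i t → ρ (r i) t) → ∀ A {t} → ⟦ A ⟧ᵍ ρ′ t → ⟦ renΛ r A ⟧ᵍ ρ t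
graph-ren⁺ h (var i) x = h i x
graph-ren⁺ h (lam A) {a ⇒ t} x = graph-ren⁺ (λ { zero → id ; (suc i) → h i }) A x
graph-ren⁺ h (app A B) (a , x , ys) = a , graph-ren⁺ h A x , All.map (graph-ren⁺ h B) ys

graph-subst⁻ : {σ : Fin n → Λ p} {ρ : Valuation p} {ρ′ : Valuation n} →
  (∀ i {t} → ⟦ σ i ⟧ᵍ ρ t → ρ′ i t) → ∀ A {t} → ⟦ substΛ σ A ⟧ᵍ ρ t → ⟦ A ⟧ᵍ ρ′ t
graph-subst⁻ h (var i) x = h i x
graph-subst⁻ {σ = σ} h (lam A) {a ⇒ t} x =
  graph-subst⁻ (λ { zero → id ; (suc i) → h i ∘ graph-ren⁻ (λ _ → id) (σ i) }) A x
graph-subst⁻ h (app A B) (a , x , ys) = a , graph-subst⁻ h A x , All.map (graph-subst⁻ h B) ys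

graph-subst⁺ : {σ : Fin n → Λ p} {ρ : Valuation p} {ρ′ : Valuation n} →
  (∀ i {t} → ρ′ i t → ⟦ σ i ⟧ᵍ ρ t) → ∀ A {t} → ⟦ A ⟧ᵍ ρ′ t → ⟦ substΛ σ A ⟧ᵍ ρ t
graph-subst⁺ h (var i) x = h i x
graph-subst⁺ {σ = σ} h (lam A) {a ⇒ t} x =
  graph-subst⁺ (λ { zero → id ; (suc i) → graph-ren⁺ (λ _ → id) (σ i) ∘ h i }) A x
graph-subst⁺ h (app A B) (a , x , ys) = a , graph-subst⁺ h A x , All.map (graph-subst⁺ h B) ys

Finite : Valuation n → (Valuation n → Set) → Set
Finite {n} ρ P = Σ[ φ ∈ (Fin n → List Token) ] ((∀ i → All (ρ i) (φ i)) × P (λ i → _∈ φ i))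

mutual
  -- A token is justified by finitely many tokens of the variables: one at a variable, both
  -- collections together at an application.
  graph-continuous : {ρ : Valuation n} → ∀ A {t} → ⟦ A ⟧ᵍ ρ t → Finite ρ (λ φ → ⟦ A ⟧ᵍ φ t)
  graph-continuous {n} {ρ} (var i) {t} x = φ , φ⊆ρ , t∈φ
    where
    φ : Fin n → List Token
    φ j with i ≟ j
    ... | yes _ = t ∷ []
    ... | no  _ = []
    φ⊆ρ : ∀ j → All (ρ j) (φ j)
    φ⊆ρ j with i ≟ j
    ... | yes refl = x ∷ []
    ... | no  _    = []
    t∈φ : t ∈ φ i
    t∈φ with i ≟ i
    ... | yes _  = here refl
    ... | no i≢i = contradiction refl i≢i
  graph-continuous (lam A) {a ⇒ t} x with graph-continuous A x
  ... | φ , φ⊆ρ , y = φ ∘ suc , φ⊆ρ ∘ suc ,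
    -- What was collected for the bound variable lies within `a`, so it is enlarged to `a` and
    -- dropped from the approximation.
    graph-mono (λ { zero → All.lookup (φ⊆ρ zero) ; (suc i) → id }) A y
  graph-continuous (app A B) (a , x , ys)
    with graph-continuous A x | graph-continuous-All B ys
  ... | φ , φ⊆ρ , x′ | ψ , ψ⊆ρ , ys′ =
    (λ i → φ i ++ ψ i) , (λ i → ++⁺ (φ⊆ρ i) (ψ⊆ρ i)) , a ,
    graph-mono (λ i → ∈-++⁺ˡ) A x′ ,
    All.map (graph-mono (λ i → ∈-++⁺ʳ (φ i)) B) ys′

  graph-continuous-All : {ρ : Valuation n} → ∀ A {a} → All (⟦ A ⟧ᵍ ρ) a →
    Finite ρ (λ φ → All (⟦ A ⟧ᵍ φ) a)
  graph-continuous-All A [] = (λ _ → []) , (λ _ → []) , []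
  graph-continuous-All A (x ∷ xs) with graph-continuous A x | graph-continuous-All A xs
  ... | φ , φ⊆ρ , x′ | ψ , ψ⊆ρ , xs′ =
    (λ i → φ i ++ ψ i) , (λ i → ++⁺ (φ⊆ρ i) (ψ⊆ρ i)) ,
    graph-mono (λ i → ∈-++⁺ˡ) A x′ ∷
    All.map (graph-mono (λ i → ∈-++⁺ʳ (φ i)) A) xs′

graph-continuous₀ : {ρ : Valuation n} {X : Token → Set} → ∀ A {t} →
  ⟦ A ⟧ᵍ (X ∷ᵛ ρ) t → ∃[ a ] (All X a × ⟦ A ⟧ᵍ ((_∈ a) ∷ᵛ ρ) t)
graph-continuous₀ A x with graph-continuous A x
... | φ , φ⊆ρ , y = φ zero , φ⊆ρ zero ,
  graph-mono (λ { zero → id ; (suc i) → All.lookup (φ⊆ρ (suc i)) }) A y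

-- Contraction is the substitution lemma. Expansion also needs continuity, which extracts from the
-- possibly infinite interpretation of `B` the finite list of tokens demanded of the argument.
graph-β : {A B : Λ n} → A →β B → ∀ {ρ t} → ⟦ A ⟧ᵍ ρ t ⇔ ⟦ B ⟧ᵍ ρ t
graph-β (β A B) {ρ} {t} = mk⇔ to from
  where
  to : ⟦ app (lam A) B ⟧ᵍ ρ t → ⟦ A [ B ]Λ ⟧ᵍ ρ t
  to (a , x , ys) = graph-subst⁺ (λ { zero → All.lookup ys ; (suc i) → id }) A x
  from : ⟦ A [ B ]Λ ⟧ᵍ ρ t → ⟦ app (lam A) B ⟧ᵍ ρ t
  from x with graph-continuous₀ A
    (graph-subst⁻ {ρ′ = ⟦ B ⟧ᵍ ρ ∷ᵛ ρ} (λ { zero → id ; (suc i) → id }) A x)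
  ... | a , ys , y = a , y , ys
graph-β (lam r) {t = base}  = ⇔-id _
graph-β (lam r) {t = a ⇒ t} = graph-β r
graph-β (appˡ r) = mk⇔ (λ (a , x , ys) → a , Equivalence.to (graph-β r) x , ys)
                       (λ (a , x , ys) → a , Equivalence.from (graph-β r) x , ys)
graph-β (appʳ r) = mk⇔ (λ (a , x , ys) → a , x , All.map (Equivalence.to (graph-β r)) ys)
                       (λ (a , x , ys) → a , x , All.map (Equivalence.from (graph-β r)) ys)

graph-=β : {A B : Λ n} → A =β B → ∀ {ρ t} → ⟦ B ⟧ᵍ ρ t → ⟦ A ⟧ᵍ ρ t
graph-=β ε            = id
graph-=β (fwd r ◅ rs) = Equivalence.from (graph-β r) ∘ graph-=β rs
graph-=β (bwd r ◅ rs) = Equivalence.to (graph-β r) ∘ graph-=β rs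

full-valuation : Valuation n
full-valuation _ _ = ⊤

-- Under `full-valuation` the head variable has every token, in particular arrows with source `[]`,
-- which ask nothing of the arguments.
VarHeaded-graph : {A : Λ n} → VarHeaded A → ∀ t → ⟦ A ⟧ᵍ full-valuation t
VarHeaded-graph (var i)   t = tt
VarHeaded-graph (app h B) t = [] , VarHeaded-graph h ([] ⇒ t) , []

HNF-graph : {A : Λ n} → HNF A → ∃[ t ] ⟦ A ⟧ᵍ full-valuation t
HNF-graph (head h) = base , VarHeaded-graph h base
HNF-graph (lam {A} h) with HNF-graph h
-- The bound variable is first allowed all tokens; continuity then cuts them down to a finite source
-- for the arrow.
... | t , x with graph-continuous₀ {X = λ _ → ⊤} A (graph-mono (λ { zero _ → tt ; (suc i) _ → tt }) A x)
... | a , _ , y = a ⇒ t , y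

-- Reducibility indexed by tokens

mutual
  Reducible : Token → Λ n → Set
  Reducible base    A = SN A
  Reducible (a ⇒ t) A = ∀ B → Reducibles a B → Reducible t (app A B)

  Reducibles : List Token → Λ n → Set
  Reducibles []      B = ⊤
  Reducibles (t ∷ a) B = Reducible t B × Reducibles a B

-- At `base`, determinism makes `B` the only reduct of `A`; at an arrow, the step survives in
-- function position.
Reducible-expand : ∀ t {A B : Λ n} → A →w B → Reducible t B → Reducible t A
Reducible-expand base    r h = acc λ r′ → transport SN (→w-deterministic r r′) h
Reducible-expand (a ⇒ t) r h C c = Reducible-expand t (appˡ r) (h C c)

VarHeaded-Reducible : ∀ t {A : Λ n} → VarHeaded A → Reducible t A
VarHeaded-Reducible base    h = acc λ r → contradiction r (VarHeaded-normal h)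
VarHeaded-Reducible (a ⇒ t) h B _ = VarHeaded-Reducible t (app h B)

VarHeaded-Reducibles : ∀ a {A : Λ n} → VarHeaded A → Reducibles a A
VarHeaded-Reducibles []      h = tt
VarHeaded-Reducibles (t ∷ a) h = VarHeaded-Reducible t h , VarHeaded-Reducibles a h

SN-appˡ : {A B : Λ n} → SN (app A B) → SN A
SN-appˡ (acc rs) = acc λ r → SN-appˡ (rs (appˡ r))

-- The scope `suc n` supplies a variable, which is reducible at every token. Applying to it strips
-- one arrow, and termination of an application passes to its function part.
Reducible⇒SN : ∀ t {A : Λ (suc n)} → Reducible t A → SN A
Reducible⇒SN base    h = h
Reducible⇒SN (a ⇒ t) h =
  SN-appˡ (Reducible⇒SN t (h (var zero) (VarHeaded-Reducibles a (var zero))))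

Reducibles-lookup : ∀ {a t} {B : Λ n} → Reducibles a B → t ∈ a → Reducible t B
Reducibles-lookup (h , _)  (here refl) = h
Reducibles-lookup (_ , hs) (there x)   = Reducibles-lookup hs x

mutual
  -- For an abstraction, applying it to a reducible argument gives a weak head redex; the induction
  -- hypothesis covers the contractum, and expansion carries reducibility back.
  adequacy : {ρ : Valuation n} {σ : Fin n → Λ p} → (∀ i {t} → ρ i t → Reducible t (σ i)) →
    ∀ A {t} → ⟦ A ⟧ᵍ ρ t → Reducible t (substΛ σ A)
  adequacy h (var i) x = h i x
  adequacy {σ = σ} h (lam A) {a ⇒ t} x B b = Reducible-expand t (β _ B)
    (transport (Reducible t) (sym (subst-exts-single σ A B))
      (adequacy (λ { zero → Reducibles-lookup b ; (suc i) → h i }) A x))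
  adequacy {σ = σ} h (app A B) (a , x , ys) = adequacy h A x (substΛ σ B) (adequacy-All h B ys)

  adequacy-All : {ρ : Valuation n} {σ : Fin n → Λ p} → (∀ i {t} → ρ i t → Reducible t (σ i)) →
    ∀ A {a} → All (⟦ A ⟧ᵍ ρ) a → Reducibles a (substΛ σ A)
  adequacy-All h A []       = tt
  adequacy-All h A (x ∷ xs) = adequacy h A x , adequacy-All h A xs

solvable⇒SN : {A : Λ (suc n)} → Solvable (lam A) → SN A
solvable⇒SN {A = A} (B , A=B , hnf) with HNF-graph hnf
... | t , x with t | graph-=β A=B x
-- The token of `lam A` cannot be `base`. Variables are reducible at every token, so the identity
-- substitution satisfies the hypothesis of `adequacy`.
... | a ⇒ t′ | y = Reducible⇒SN t′ (transport (Reducible t′) (subst-id (λ _ → refl) A)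
  (adequacy (λ i _ → VarHeaded-Reducible _ (var i)) A y))

-- The CPS translation with an environment of target terms: ordinary variables
-- denote W-terms and continuation variables K-terms, so that substitution,
-- J{l/m} and J{[k]□ ↦ …} on the source all become changes of environment.

Env : Ctx → ℕ → Set
Env Γ n = ∀ {s} → s ∈ Γ → Λ n

wkΛ : Λ n → Λ (suc n)
wkΛ = renΛ suc

wkEnv : Env Γ n → Env Γ (suc n)
wkEnv η x = wkΛ (η x)

infixl 5 _▸_
_▸_ : Env Γ n → Λ n → Env (s ∷ Γ) n
(η ▸ A) Z     = A
(η ▸ A) (S x) = η x

liftEnv : Env Γ n → Env (s ∷ Γ) (suc n)
liftEnv η = wkEnv η ▸ var zero

mutual
  cpsΛ : Term merged Γ → Env Γ n → Λ n → Λ n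
  cpsΛ (var x)      η C = app C (η x)
  cpsΛ (ƛ M)        η C = app C (starΛ (ƛ M) (ƛ M) η)
  cpsΛ (M · N)      η C = cpsApp M N (value? M) (value? N) η C
  cpsΛ (L where≔ M) η C = cpsΛ M η (lam (cpsΛ L (liftEnv η) (wkΛ C)))
  cpsΛ (μ J)        η C = app (lam (jumpΛ J (liftEnv η))) C

  -- The four clauses for application are factored in two: first the function part, then `cpsArg`
  -- with the function's target value `F`. The decisions are arguments so that proofs can split on
  -- them directly.
  cpsApp : (M N : Term merged Γ) → Dec (Value M) → Dec (Value N) → Env Γ n → Λ n → Λ n
  cpsApp M N (yes v) d η C = cpsArg N d η (starΛ M v η) C
  cpsApp M N (no _)  d η C = cpsΛ M η (lam (cpsArg N d (wkEnv η) (var zero) (wkΛ C)))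

  cpsArg : (N : Term merged Γ) → Dec (Value N) → Env Γ n → Λ n → Λ n → Λ n
  cpsArg N (yes w) η F C = app (app F (starΛ N w η)) C
  cpsArg N (no _)  η F C = cpsΛ N η (lam (app (app (wkΛ F) (var zero)) (wkΛ C)))

  jumpΛ : Jump merged Γ → Env Γ n → Λ n
  jumpΛ ([ k ] M) η = cpsΛ M η (η k)

  starΛ : (V : Term merged Γ) → Value V → Env Γ n → Λ n
  starΛ (var x) _ η = η x
  starΛ (ƛ M)   _ η = lam (lam (cpsΛ M (wkEnv (liftEnv η)) (var zero)))

cpsΛ-value : {V : Term merged Γ} (v : Value V) (η : Env Γ n) → ∀ C →
  cpsΛ V η C ≡ app C (starΛ V v η)
cpsΛ-value (var x) η C = refl
cpsΛ-value (ƛ M)   η C = refl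

-- Target substitution into translated terms

SubstEnv : (Fin n → Λ p) → Env Γ n → Env Γ p → Set
SubstEnv {Γ = Γ} σ η η′ = ∀ {s} (x : s ∈ Γ) → substΛ σ (η x) ≡ η′ x

SubstEnv-wk : {σ : Fin n → Λ p} (η : Env Γ n) (η′ : Env Γ p) →
  SubstEnv σ η η′ → SubstEnv (extsΛ σ) (wkEnv η) (wkEnv η′)
SubstEnv-wk {σ = σ} η η′ h x = trans (subst-wk σ (η x)) (cong wkΛ (h x))

SubstEnv-lift : {σ : Fin n → Λ p} (η : Env Γ n) (η′ : Env Γ p) →
  SubstEnv σ η η′ → SubstEnv (extsΛ σ) (liftEnv {s = s} η) (liftEnv η′)
SubstEnv-lift η η′ h Z     = refl
SubstEnv-lift η η′ h (S x) = SubstEnv-wk η η′ h x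

mutual
  -- Free target variables enter a translation only through the environment and the continuation, so
  -- a substitution acts on these alone.
  substΛ-cps : {σ : Fin n → Λ p} (η : Env Γ n) (η′ : Env Γ p) → SubstEnv σ η η′ →
    ∀ M C → substΛ σ (cpsΛ M η C) ≡ cpsΛ M η′ (substΛ σ C)
  substΛ-cps η η′ h (var x) C = cong (app _) (h x)
  substΛ-cps η η′ h (ƛ M)   C = cong (app _) (substΛ-star η η′ h (ƛ M) (ƛ M))
  substΛ-cps η η′ h (M · N) C = substΛ-app η η′ h M N (value? M) (value? N) C
  substΛ-cps {σ = σ} η η′ h (L where≔ M) C = trans (substΛ-cps η η′ h M _)
    (cong (λ A → cpsΛ M η′ (lam A))
      (trans (substΛ-cps (liftEnv η) (liftEnv η′) (SubstEnv-lift η η′ h) L (wkΛ C))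
             (cong (cpsΛ L (liftEnv η′)) (subst-wk σ C))))
  substΛ-cps η η′ h (μ J) C =
    cong (λ A → app (lam A) _) (substΛ-jump (liftEnv η) (liftEnv η′) (SubstEnv-lift η η′ h) J)

  substΛ-app : {σ : Fin n → Λ p} (η : Env Γ n) (η′ : Env Γ p) → SubstEnv σ η η′ →
    ∀ M N d e C → substΛ σ (cpsApp M N d e η C) ≡ cpsApp M N d e η′ (substΛ σ C)
  substΛ-app η η′ h M N (yes v) e C = trans (substΛ-arg η η′ h N e (starΛ M v η) C)
    (cong (λ F → cpsArg N e η′ F _) (substΛ-star η η′ h M v))
  substΛ-app {σ = σ} η η′ h M N (no _) e C = trans (substΛ-cps η η′ h M _)
    (cong (λ A → cpsΛ M η′ (lam A))
      (trans (substΛ-arg (wkEnv η) (wkEnv η′) (SubstEnv-wk η η′ h) N e (var zero) (wkΛ C))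
             (cong (cpsArg N e (wkEnv η′) (var zero)) (subst-wk σ C))))

  substΛ-arg : {σ : Fin n → Λ p} (η : Env Γ n) (η′ : Env Γ p) → SubstEnv σ η η′ →
    ∀ N e F C → substΛ σ (cpsArg N e η F C) ≡ cpsArg N e η′ (substΛ σ F) (substΛ σ C)
  substΛ-arg η η′ h N (yes w) F C = cong (λ A → app (app _ A) _) (substΛ-star η η′ h N w)
  substΛ-arg {σ = σ} η η′ h N (no _) F C = trans (substΛ-cps η η′ h N _)
    (cong₂ (λ A B → cpsΛ N η′ (lam (app (app A (var zero)) B))) (subst-wk σ F) (subst-wk σ C))

  substΛ-jump : {σ : Fin n → Λ p} (η : Env Γ n) (η′ : Env Γ p) → SubstEnv σ η η′ →
    ∀ J → substΛ σ (jumpΛ J η) ≡ jumpΛ J η′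
  substΛ-jump η η′ h ([ k ] M) = trans (substΛ-cps η η′ h M (η k)) (cong (cpsΛ M η′) (h k))

  substΛ-star : {σ : Fin n → Λ p} (η : Env Γ n) (η′ : Env Γ p) → SubstEnv σ η η′ →
    ∀ V v → substΛ σ (starΛ V v η) ≡ starΛ V v η′
  substΛ-star η η′ h (var x) v = h x
  substΛ-star η η′ h (ƛ M)   v = cong (λ A → lam (lam A))
    (substΛ-cps (wkEnv (liftEnv η)) (wkEnv (liftEnv η′))
      (SubstEnv-wk (liftEnv η) (liftEnv η′) (SubstEnv-lift η η′ h)) M (var zero))

renΛ-cps : {ρ : Fin n → Fin p} (η : Env Γ n) (η′ : Env Γ p) →
  (∀ {s} (x : s ∈ Γ) → renΛ ρ (η x) ≡ η′ x) →
  ∀ M C → renΛ ρ (cpsΛ M η C) ≡ cpsΛ M η′ (renΛ ρ C)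
renΛ-cps η η′ h M C = trans (ren-as-subst (λ _ → refl) _)
  (trans (substΛ-cps η η′ (λ x → trans (sym (ren-as-subst (λ _ → refl) (η x))) (h x)) M C)
         (cong (cpsΛ M η′) (sym (ren-as-subst (λ _ → refl) C))))

-- Source operations are absorbed into the environment

-- Being a value is recorded in both directions because the translation of an application branches
-- on it.
record Agree (M : Term merged Γ) (η : Env Γ n) (M′ : Term merged Δ) (η′ : Env Δ n) : Set where
  field
    value⁺ : Value M → Value M′
    value⁻ : Value M′ → Value M
    cps≡   : ∀ C → cpsΛ M η C ≡ cpsΛ M′ η′ C

open Agree

app-injectiveʳ : {A B A′ B′ : Λ n} → app A B ≡ app A′ B′ → B ≡ B′
app-injectiveʳ refl = refl

-- A value translates to the continuation applied to its star, so injectivity of application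
-- recovers the star. The continuation is arbitrary; `C` is merely a term available in scope.
Agree-star : {M : Term merged Γ} {η : Env Γ n} {M′ : Term merged Δ} {η′ : Env Δ n} →
  Agree M η M′ η′ → ∀ v v′ → starΛ M v η ≡ starΛ M′ v′ η′
Agree-star {M = M} {η} {M′} {η′} h v v′ = app-injectiveʳ {A = C} {A′ = C}
  (trans (sym (cpsΛ-value v η C)) (trans (cps≡ h C) (cpsΛ-value v′ η′ C)))
  where C = starΛ M v η

cpsArg-agree : {N : Term merged Γ} {η : Env Γ n} {N′ : Term merged Δ} {η′ : Env Δ n} →
  Agree N η N′ η′ → ∀ d d′ F C → cpsArg N d η F C ≡ cpsArg N′ d′ η′ F C
cpsArg-agree h (yes w) (yes w′) F C = cong (λ A → app (app F A) C) (Agree-star h w w′)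
cpsArg-agree h (yes w) (no ¬w′) F C = contradiction (value⁺ h w) ¬w′
cpsArg-agree h (no ¬w) (yes w′) F C = contradiction (value⁻ h w′) ¬w
cpsArg-agree h (no ¬w) (no ¬w′) F C = cps≡ h _

-- `Agree` concerns one fixed pair of environments, whereas `N` is translated under an extra target
-- binder when `M` is not a value; hence the second hypothesis on `N`.
cpsApp-agree : {M N : Term merged Γ} {η : Env Γ n} {M′ N′ : Term merged Δ} {η′ : Env Δ n} →
  Agree M η M′ η′ → Agree N η N′ η′ → Agree N (wkEnv η) N′ (wkEnv η′) →
  ∀ d d′ e e′ C → cpsApp M N d e η C ≡ cpsApp M′ N′ d′ e′ η′ C
cpsApp-agree {N = N} {η} f g g′ (yes v) (yes v′) e e′ C =
  trans (cong (λ F → cpsArg N e η F C) (Agree-star f v v′)) (cpsArg-agree g e e′ _ C)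
cpsApp-agree f g g′ (yes v) (no ¬v′) e e′ C = contradiction (value⁺ f v) ¬v′
cpsApp-agree f g g′ (no ¬v) (yes v′) e e′ C = contradiction (value⁻ f v′) ¬v
cpsApp-agree {M′ = M′} {η′ = η′} f g g′ (no _) (no _) e e′ C = trans (cps≡ f _)
  (cong (λ A → cpsΛ M′ η′ (lam A)) (cpsArg-agree g′ e e′ (var zero) (wkΛ C)))

·-agree : {M N : Term merged Γ} {η : Env Γ n} {M′ N′ : Term merged Δ} {η′ : Env Δ n} →
  Agree M η M′ η′ → Agree N η N′ η′ → Agree N (wkEnv η) N′ (wkEnv η′) →
  Agree (M · N) η (M′ · N′) η′
·-agree {M = M} {N} {M′ = M′} {N′} f g g′ = record
  { value⁺ = λ () ; value⁻ = λ ()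
  ; cps≡ = cpsApp-agree f g g′ (value? M) (value? M′) (value? N) (value? N′) }

ƛ-agree : {M : Term merged (ord ∷ Γ)} {η : Env Γ n} {M′ : Term merged (ord ∷ Δ)} {η′ : Env Δ n} →
  Agree M (wkEnv (liftEnv η)) M′ (wkEnv (liftEnv η′)) → Agree (ƛ M) η (ƛ M′) η′
ƛ-agree f = record
  { value⁺ = λ _ → ƛ _ ; value⁻ = λ _ → ƛ _
  ; cps≡ = λ C → cong (λ A → app C (lam (lam A))) (cps≡ f _) }

where-agree : {L : Term merged (ord ∷ Γ)} {M : Term merged Γ} {η : Env Γ n}
  {L′ : Term merged (ord ∷ Δ)} {M′ : Term merged Δ} {η′ : Env Δ n} →
  Agree L (liftEnv η) L′ (liftEnv η′) → Agree M η M′ η′ → Agree (L where≔ M) η (L′ where≔ M′) η′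
where-agree {M′ = M′} {η′} f g = record
  { value⁺ = λ () ; value⁻ = λ ()
  ; cps≡ = λ C → trans (cps≡ g _) (cong (λ A → cpsΛ M′ η′ (lam A)) (cps≡ f (wkΛ C))) }

μ-agree : {J : Jump merged (cont ∷ Γ)} {η : Env Γ n} {J′ : Jump merged (cont ∷ Δ)} {η′ : Env Δ n} →
  jumpΛ J (liftEnv η) ≡ jumpΛ J′ (liftEnv η′) → Agree (μ J) η (μ J′) η′
μ-agree f = record
  { value⁺ = λ () ; value⁻ = λ () ; cps≡ = λ C → cong (λ A → app (lam A) C) f }

RenEnv : Γ ⊆ Δ → Env Δ n → Env Γ n → Set
RenEnv {Γ = Γ} ρ η η′ = ∀ {s} (x : s ∈ Γ) → η (ρ x) ≡ η′ x

RenEnv-wk : (ρ : Γ ⊆ Δ) (η : Env Δ n) (η′ : Env Γ n) →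
  RenEnv ρ η η′ → RenEnv ρ (wkEnv η) (wkEnv η′)
RenEnv-wk ρ η η′ h x = cong wkΛ (h x)

RenEnv-lift : (ρ : Γ ⊆ Δ) (η : Env Δ n) (η′ : Env Γ n) →
  RenEnv ρ η η′ → RenEnv (ext {s = s} ρ) (liftEnv η) (liftEnv η′)
RenEnv-lift ρ η η′ h Z     = refl
RenEnv-lift ρ η η′ h (S x) = cong wkΛ (h x)

mutual
  ren-agree : (ρ : Γ ⊆ Δ) (η : Env Δ n) (η′ : Env Γ n) → RenEnv ρ η η′ →
    ∀ M → Agree (ren ρ M) η M η′
  ren-agree ρ η η′ h (var x) = record
    { value⁺ = λ _ → var x ; value⁻ = λ _ → var _ ; cps≡ = λ C → cong (app C) (h x) }
  ren-agree ρ η η′ h (ƛ M) = ƛ-agree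
    (ren-agree (ext ρ) _ _
      (RenEnv-wk (ext ρ) (liftEnv η) (liftEnv η′) (RenEnv-lift ρ η η′ h)) M)
  ren-agree ρ η η′ h (M · N) = ·-agree (ren-agree ρ η η′ h M) (ren-agree ρ η η′ h N)
    (ren-agree ρ _ _ (RenEnv-wk ρ η η′ h) N)
  ren-agree ρ η η′ h (L where≔ M) = where-agree
    (ren-agree (ext ρ) _ _ (RenEnv-lift ρ η η′ h) L) (ren-agree ρ η η′ h M)
  ren-agree ρ η η′ h (μ J) = μ-agree (renJ-agree (ext ρ) _ _ (RenEnv-lift ρ η η′ h) J)

  renJ-agree : (ρ : Γ ⊆ Δ) (η : Env Δ n) (η′ : Env Γ n) → RenEnv ρ η η′ →
    ∀ J → jumpΛ (renJ ρ J) η ≡ jumpΛ J η′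
  renJ-agree ρ η η′ h ([ k ] M) =
    trans (cps≡ (ren-agree ρ η η′ h M) (η (ρ k))) (cong (cpsΛ M η′) (h k))

starΛ-wkEnv : (η : Env Γ n) → ∀ V v → starΛ V v (wkEnv η) ≡ wkΛ (starΛ V v η)
starΛ-wkEnv η V v = sym (trans (ren-as-subst (λ _ → refl) _)
  (substΛ-star η (wkEnv η) (λ x → sym (ren-as-subst (λ _ → refl) (η x))) V v))

-- An ordinary variable denotes a W-term, and only values have one; so the substituted terms are
-- required to be values.
record SubEnv (σ : Sub merged Γ Δ) (η : Env Δ n) (η′ : Env Γ n) : Set where
  field
    values : ∀ x → Value (Sub.tm σ x)
    ords   : ∀ x → starΛ (Sub.tm σ x) (values x) η ≡ η′ x
    conts  : ∀ k → η (Sub.kv σ k) ≡ η′ k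

open SubEnv

wk-value : {V : Term merged Γ} → Value V → Value (wk {s = s} V)
wk-value (var x) = var _
wk-value (ƛ M)   = ƛ _

wk-agree : (η : Env Γ n) (A : Λ n) → ∀ M → Agree (wk {s = s} M) (η ▸ A) M η
wk-agree η A = ren-agree there (η ▸ A) η (λ _ → refl)

SubEnv-wk : (σ : Sub merged Γ Δ) (η : Env Δ n) (η′ : Env Γ n) →
  SubEnv σ η η′ → SubEnv σ (wkEnv η) (wkEnv η′)
SubEnv-wk σ η η′ h = record
  { values = values h
  ; ords   = λ x → trans (starΛ-wkEnv η _ (values h x)) (cong wkΛ (ords h x))
  ; conts  = λ k → cong wkΛ (conts h k) }

SubEnv-▸ : (σ : Sub merged Γ Δ) (η : Env Δ n) (η′ : Env Γ n) (A : Λ n) →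
  SubEnv σ η η′ → SubEnv (extSub {s = s} σ) (η ▸ A) (η′ ▸ A)
SubEnv-▸ σ η η′ A h = record
  { values = λ { Z → var Z ; (S x) → wk-value (values h x) }
  ; ords   = λ { Z → refl
               ; (S x) → trans (Agree-star (wk-agree η A (Sub.tm σ x))
                                           (wk-value (values h x)) (values h x))
                               (ords h x) }
  ; conts  = λ { Z → refl ; (S k) → conts h k } }

SubEnv-lift : (σ : Sub merged Γ Δ) (η : Env Δ n) (η′ : Env Γ n) →
  SubEnv σ η η′ → SubEnv (extSub {s = s} σ) (liftEnv η) (liftEnv η′)
SubEnv-lift σ η η′ h = SubEnv-▸ σ (wkEnv η) (wkEnv η′) (var zero) (SubEnv-wk σ η η′ h)

mutual
  subst-agree : (σ : Sub merged Γ Δ) (η : Env Δ n) (η′ : Env Γ n) → SubEnv σ η η′ →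
    ∀ M → Agree (subst σ M) η M η′
  subst-agree σ η η′ h (var x) = record
    { value⁺ = λ _ → var x ; value⁻ = λ _ → values h x
    ; cps≡ = λ C → trans (cpsΛ-value (values h x) η C) (cong (app C) (ords h x)) }
  subst-agree σ η η′ h (ƛ M) = ƛ-agree
    (subst-agree (extSub σ) _ _
      (SubEnv-wk (extSub σ) (liftEnv η) (liftEnv η′) (SubEnv-lift σ η η′ h)) M)
  subst-agree σ η η′ h (M · N) = ·-agree (subst-agree σ η η′ h M) (subst-agree σ η η′ h N)
    (subst-agree σ _ _ (SubEnv-wk σ η η′ h) N)
  subst-agree σ η η′ h (L where≔ M) = where-agree
    (subst-agree (extSub σ) _ _ (SubEnv-lift σ η η′ h) L) (subst-agree σ η η′ h M)
  subst-agree σ η η′ h (μ J) = μ-agree (substJ-agree (extSub σ) _ _ (SubEnv-lift σ η η′ h) J)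

  substJ-agree : (σ : Sub merged Γ Δ) (η : Env Δ n) (η′ : Env Γ n) → SubEnv σ η η′ →
    ∀ J → jumpΛ (substJ σ J) η ≡ jumpΛ J η′
  substJ-agree σ η η′ h ([ k ] M) =
    trans (cps≡ (subst-agree σ η η′ h M) (η (Sub.kv σ k))) (cong (cpsΛ M η′) (conts h k))

[/x]-cps : {V : Term merged Γ} (v : Value V) (η : Env Γ n) → ∀ M C →
  cpsΛ (M [ V /x]) η C ≡ cpsΛ M (η ▸ starΛ V v η) C
[/x]-cps {V = V} v η M = cps≡ (subst-agree _ η (η ▸ starΛ V v η) (record
  { values = λ { Z → v ; (S x) → var x }
  ; ords   = λ { Z → refl ; (S x) → refl }
  ; conts  = λ { (here ()) ; (S k) → refl } }) M)

-- {[k]□ ↦ [k](N where x:=□)} amounts to rebinding k to λx.⟨N⟩[k].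
record CtxEnv (k : cont ∈ Γ) (N : Term merged (ord ∷ Γ)) (η η′ : Env Γ n) : Set where
  field
    ords   : ∀ (x : ord ∈ Γ) → η x ≡ η′ x
    others : ∀ l → l ≢ k → η l ≡ η′ l
    target : lam (cpsΛ N (liftEnv η) (wkΛ (η k))) ≡ η′ k

CtxEnv-wk : (k : cont ∈ Γ) (N : Term merged (ord ∷ Γ)) (η η′ : Env Γ n) →
  CtxEnv k N η η′ → CtxEnv k N (wkEnv η) (wkEnv η′)
CtxEnv-wk k N η η′ h = record
  { ords   = λ x → cong wkΛ (CtxEnv.ords h x)
  ; others = λ l l≢k → cong wkΛ (CtxEnv.others h l l≢k)
  ; target = trans (cong lam (sym
      (trans (renΛ-cps (liftEnv η) (liftEnv (wkEnv η))
                (λ { Z → refl ; (S x) → ren-wk suc (η x) }) N (wkΛ (η k)))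
             (cong (cpsΛ N (liftEnv (wkEnv η))) (ren-wk suc (η k))))))
      (cong wkΛ (CtxEnv.target h)) }

CtxEnv-▸ : (k : cont ∈ Γ) (N : Term merged (ord ∷ Γ)) (η η′ : Env Γ n) (A : Λ n) →
  CtxEnv k N η η′ → CtxEnv {s ∷ Γ} (S k) (ren (ext there) N) (η ▸ A) (η′ ▸ A)
CtxEnv-▸ k N η η′ A h = record
  { ords   = λ { Z → refl ; (S x) → CtxEnv.ords h x }
  ; others = λ { Z _ → refl ; (S l) l≢k → CtxEnv.others h l (l≢k ∘ cong there) }
  ; target = trans (cong lam (cps≡ (ren-agree (ext there) (liftEnv (η ▸ A)) (liftEnv η)
                     (λ { Z → refl ; (S x) → refl }) N) _))
                   (CtxEnv.target h) }

CtxEnv-lift : (k : cont ∈ Γ) (N : Term merged (ord ∷ Γ)) (η η′ : Env Γ n) →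
  CtxEnv k N η η′ → CtxEnv {s ∷ Γ} (S k) (ren (ext there) N) (liftEnv η) (liftEnv η′)
CtxEnv-lift k N η η′ h =
  CtxEnv-▸ k N (wkEnv η) (wkEnv η′) (var zero) (CtxEnv-wk k N η η′ h)

mutual
  ctxSub-agree : (k : cont ∈ Γ) (N : Term merged (ord ∷ Γ)) (η η′ : Env Γ n) → CtxEnv k N η η′ →
    ∀ M → Agree (ctxSub k N M) η M η′
  ctxSub-agree k N η η′ h (var x) = record
    { value⁺ = id ; value⁻ = id ; cps≡ = λ C → cong (app C) (CtxEnv.ords h x) }
  ctxSub-agree k N η η′ h (ƛ M) = ƛ-agree
    (ctxSub-agree (S k) _ _ _
      (CtxEnv-wk (S k) _ (liftEnv η) (liftEnv η′) (CtxEnv-lift k N η η′ h)) M)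
  ctxSub-agree k N η η′ h (L · M) = ·-agree (ctxSub-agree k N η η′ h L) (ctxSub-agree k N η η′ h M)
    (ctxSub-agree k N _ _ (CtxEnv-wk k N η η′ h) M)
  ctxSub-agree k N η η′ h (L where≔ M) = where-agree
    (ctxSub-agree (S k) _ _ _ (CtxEnv-lift k N η η′ h) L) (ctxSub-agree k N η η′ h M)
  ctxSub-agree k N η η′ h (μ J) =
    μ-agree (ctxSubJ-agree (S k) _ _ _ (CtxEnv-lift k N η η′ h) J)

  ctxSubJ-agree : (k : cont ∈ Γ) (N : Term merged (ord ∷ Γ)) (η η′ : Env Γ n) → CtxEnv k N η η′ →
    ∀ J → jumpΛ (ctxSubJ k N J) η ≡ jumpΛ J η′
  ctxSubJ-agree k N η η′ h ([ l ] M) with l ≟ᵛ k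
  -- The `where` inserted at the label `k` computes to the continuation on the left of `target`.
  ... | yes refl = trans (cps≡ (ctxSub-agree k N η η′ h M) _) (cong (cpsΛ M η′) (CtxEnv.target h))
  ... | no l≢k   = trans (cps≡ (ctxSub-agree k N η η′ h M) _) (cong (cpsΛ M η′) (CtxEnv.others h l l≢k))

-- Erasure of the CPS translation

IndexRen : Γ ⊆ Δ → (Fin (length Γ) → Fin (length Δ)) → Set
IndexRen {Γ = Γ} ρ r = ∀ {s} (x : s ∈ Γ) → index (ρ x) ≡ r (index x)

IndexRen-ext : (ρ : Γ ⊆ Δ) (r : Fin (length Γ) → Fin (length Δ)) →
  IndexRen ρ r → IndexRen (ext {s = s} ρ) (extΛ r)
IndexRen-ext ρ r h Z     = refl
IndexRen-ext ρ r h (S x) = cong suc (h x)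

erase-renT : ∀ {u} (ρ : Γ ⊆ Δ) (r : Fin (length Γ) → Fin (length Δ)) → IndexRen ρ r →
  ∀ (A : Target u Γ) → erase (renT ρ A) ≡ renΛ r (erase A)
erase-renT ρ r h (ƛk A)    = cong lam (erase-renT (ext ρ) (extΛ r) (IndexRen-ext ρ r h) A)
erase-renT ρ r h (A ·ww B) = cong₂ app (erase-renT ρ r h A) (erase-renT ρ r h B)
erase-renT ρ r h (A ·kw B) = cong₂ app (erase-renT ρ r h A) (erase-renT ρ r h B)
erase-renT ρ r h (A ·tk B) = cong₂ app (erase-renT ρ r h A) (erase-renT ρ r h B)
erase-renT ρ r h (wvar x)  = cong var (h x)
erase-renT ρ r h (ƛw A)    = cong lam (erase-renT (ext ρ) (extΛ r) (IndexRen-ext ρ r h) A)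
erase-renT ρ r h (kvar k)  = cong var (h k)
erase-renT ρ r h (ƛq A)    = cong lam (erase-renT (ext ρ) (extΛ r) (IndexRen-ext ρ r h) A)

erase-wkT : ∀ {u} (A : Target u Γ) → erase (wkT {s = s} A) ≡ wkΛ (erase A)
erase-wkT = erase-renT there suc (λ _ → refl)

merge-value⁺ : ∀ {f} {M : Term f Γ} → Value M → Value (merge M)
merge-value⁺ (var x) = var x
merge-value⁺ (ƛ M)   = ƛ _

merge-value⁻ : ∀ {f} (M : Term f Γ) → Value (merge M) → Value M
merge-value⁻ (var x) _ = var x
merge-value⁻ (ƛ M)   _ = ƛ M

VarEnv : Γ ⊆ Δ → Env Γ (length Δ) → Set
VarEnv {Γ = Γ} ρ η = ∀ {s} (x : s ∈ Γ) → var (index (ρ x)) ≡ η x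

VarEnv-lift : (ρ : Γ ⊆ Δ) (η : Env Γ (length Δ)) → VarEnv ρ η → VarEnv (ext {s = s} ρ) (liftEnv η)
VarEnv-lift ρ η h Z     = refl
VarEnv-lift ρ η h (S x) = cong wkΛ (h x)

-- This justifies identifying the two jump forms: once the label is seen to be `S k`, both
-- translations compute to the same term.
pushWhere-cps : ∀ J (M : Term merged Γ) (η : Env Γ n) →
  jumpΛ (pushWhere J M) η ≡ cpsΛ M η (lam (jumpΛ J (liftEnv η)))
pushWhere-cps ([ S k ] L) M η = refl

mutual
  -- Connects the sorted translation of the full grammar with the environment translation of merged
  -- terms, on which the simulation is carried out.
  erase-cps : ∀ {f} (ρ : Γ ⊆ Δ) (η : Env Γ (length Δ)) → VarEnv ρ η →
    ∀ (M : Term f Γ) C → erase (cps M ρ C) ≡ cpsΛ (merge M) η (erase C)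
  erase-cps ρ η h (var x) C = cong (app _) (h x)
  erase-cps ρ η h (ƛ M)   C = cong (app _) (erase-star ρ η h (ƛ M) (ƛ M) (ƛ _))
  erase-cps ρ η h (M · N) C with value? M | value? N | value? (merge M) | value? (merge N)
  ... | yes v | yes w | yes v′ | yes w′ =
    cong₂ (λ A B → app (app A B) _) (erase-star ρ η h M v v′) (erase-star ρ η h N w w′)
  ... | yes v | no _  | yes v′ | no _   = trans (erase-cps ρ η h N _)
    (cong₂ (λ A B → cpsΛ (merge N) η (lam (app (app A (var zero)) B)))
      (trans (erase-star (there ∘ ρ) (wkEnv η) (λ x → cong wkΛ (h x)) M v v′)
             (starΛ-wkEnv η (merge M) v′))
      (erase-wkT C))
  ... | no _  | yes w | no _   | yes w′ = trans (erase-cps ρ η h M _)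
    (cong₂ (λ A B → cpsΛ (merge M) η (lam (app (app (var zero) A) B)))
      (erase-star (there ∘ ρ) (wkEnv η) (λ x → cong wkΛ (h x)) N w w′)
      (erase-wkT C))
  ... | no _  | no _  | no _   | no _   = trans (erase-cps ρ η h M _)
    (cong (λ A → cpsΛ (merge M) η (lam A))
      (trans (erase-cps (there ∘ ρ) (wkEnv η) (λ x → cong wkΛ (h x)) N _)
        (cong (λ A → cpsΛ (merge N) (wkEnv η) (lam (app _ A)))
          (trans (erase-wkT (wkT C)) (cong wkΛ (erase-wkT C))))))
  -- Merging preserves and reflects values, so the two pairs of decisions cannot disagree.
  ... | yes v | _     | no ¬v′ | _      = contradiction (merge-value⁺ v) ¬v′
  ... | no ¬v | _     | yes v′ | _      = contradiction (merge-value⁻ M v′) ¬v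
  ... | _     | yes w | _      | no ¬w′ = contradiction (merge-value⁺ w) ¬w′
  ... | _     | no ¬w | _      | yes w′ = contradiction (merge-value⁻ N w′) ¬w
  erase-cps ρ η h (L where≔ M) C = trans (erase-cps ρ η h M _)
    (cong (λ A → cpsΛ (merge M) η (lam A))
      (trans (erase-cps (ext ρ) (liftEnv η) (VarEnv-lift ρ η h) L (wkT C))
             (cong (cpsΛ (merge L) (liftEnv η)) (erase-wkT C))))
  erase-cps ρ η h (μ J) C =
    cong (λ A → app (lam A) _) (erase-cpsJ (ext ρ) (liftEnv η) (VarEnv-lift ρ η h) J)

  erase-cpsJ : ∀ {f} (ρ : Γ ⊆ Δ) (η : Env Γ (length Δ)) → VarEnv ρ η →
    ∀ (J : Jump f Γ) → erase (cpsJ J ρ) ≡ jumpΛ (mergeJ J) η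
  erase-cpsJ ρ η h ([ k ] M) =
    trans (erase-cps ρ η h M (kvar (ρ k))) (cong (cpsΛ (merge M) η) (h k))
  erase-cpsJ ρ η h (J whereJ≔ M) = trans (erase-cps ρ η h M _)
    (trans (cong (λ A → cpsΛ (merge M) η (lam A))
             (erase-cpsJ (ext ρ) (liftEnv η) (VarEnv-lift ρ η h) J))
           (sym (pushWhere-cps (mergeJ J) (merge M) η)))

  erase-star : ∀ {f} (ρ : Γ ⊆ Δ) (η : Env Γ (length Δ)) → VarEnv ρ η →
    ∀ (V : Term f Γ) v v′ → erase (star V v ρ) ≡ starΛ (merge V) v′ η
  erase-star ρ η h (var x) v v′ = h x
  erase-star ρ η h (ƛ M)   v v′ = cong (λ A → lam (lam A))
    (erase-cps (there ∘ ext ρ) (wkEnv (liftEnv η))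
      (λ x → cong wkΛ (VarEnv-lift ρ η h x)) M (kvar Z))

-- Evaluation contexts as continuations

starΛ-irrelevant : (V : Term merged Γ) (v v′ : Value V) (η : Env Γ n) → starΛ V v η ≡ starΛ V v′ η
starΛ-irrelevant (var x) v v′ η = refl
starΛ-irrelevant (ƛ M)   v v′ η = refl

cpsArg-value : {N : Term merged Γ} (w : Value N) (η : Env Γ n) → ∀ F C →
  cpsArg N (value? N) η F C ≡ app (app F (starΛ N w η)) C
cpsArg-value {N = N} w η F C with value? N
... | yes w′ = cong (λ A → app (app F A) C) (starΛ-irrelevant N w′ w η)
... | no ¬w  = contradiction w ¬w

cpsArg-nonvalue : {N : Term merged Γ} → ¬ Value N → (η : Env Γ n) → ∀ F C →
  cpsArg N (value? N) η F C ≡ cpsΛ N η (lam (app (app (wkΛ F) (var zero)) (wkΛ C)))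
cpsArg-nonvalue {N = N} ¬w η F C with value? N
... | yes w = contradiction w ¬w
... | no _  = refl

cpsΛ-value-· : {V : Term merged Γ} (v : Value V) (N : Term merged Γ) (η : Env Γ n) → ∀ C →
  cpsΛ (V · N) η C ≡ cpsArg N (value? N) η (starΛ V v η) C
cpsΛ-value-· {V = V} v N η C with value? V
... | yes v′ = cong (λ F → cpsArg N (value? N) η F C) (starΛ-irrelevant V v′ v η)
... | no ¬v  = contradiction v ¬v

cpsΛ-nonvalue-· : {M : Term merged Γ} → ¬ Value M → (N : Term merged Γ) (η : Env Γ n) → ∀ C →
  cpsΛ (M · N) η C ≡ cpsΛ M η (lam (cpsArg N (value? N) (wkEnv η) (var zero) (wkΛ C)))
cpsΛ-nonvalue-· {M = M} ¬v N η C with value? M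
... | yes v = contradiction v ¬v
... | no _  = refl

ctxΛ : EvalCtx Γ → Env Γ n → Λ n → Λ n
ctxΛ □ η C = C
ctxΛ (_[_·□] E {V} v) η C = lam (app (app (wkΛ (starΛ V v η)) (var zero)) (wkΛ (ctxΛ E η C)))
ctxΛ (E [□· M ]) η C = lam (cpsArg M (value? M) (wkEnv η) (var zero) (wkΛ (ctxΛ E η C)))
ctxΛ (E [ M ≔□]) η C = lam (cpsΛ M (liftEnv η) (wkΛ (ctxΛ E η C)))

-- With a non-value in the hole, each frame selects the clause that turns it into a continuation.
-- Contexts grow at the hole, so the induction refills `E` with an application or a `where`, again a
-- non-value.
cpsΛ-plug : ∀ E {L : Term merged Γ} → ¬ Value L → (η : Env Γ n) → ∀ C →
  cpsΛ (E ⟦ L ⟧) η C ≡ cpsΛ L η (ctxΛ E η C)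
cpsΛ-plug □ ¬v η C = refl
cpsΛ-plug (E [ v ·□]) {L} ¬v η C = trans (cpsΛ-plug E (λ ()) η C)
  (trans (cpsΛ-value-· v L η (ctxΛ E η C)) (cpsArg-nonvalue ¬v η _ _))
cpsΛ-plug (E [□· M ]) ¬v η C = trans (cpsΛ-plug E (λ ()) η C) (cpsΛ-nonvalue-· ¬v M η _)
cpsΛ-plug (E [ M ≔□]) ¬v η C = cpsΛ-plug E (λ ()) η C

→w-β : (A : Λ (suc n)) (B : Λ n) {X : Λ n} → substΛ (B ∷ˢ var) A ≡ X → app (lam A) B →w X
→w-β A B refl = transport (app (lam A) B →w_) ([]Λ-subst A B) (β A B)

SubstEnv-single : (η : Env Γ n) (A : Λ n) → SubstEnv (A ∷ˢ var) (liftEnv {s = s} η) (η ▸ A)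
SubstEnv-single η A Z     = refl
SubstEnv-single η A (S x) = subst-single-wk (η x) A

cpsΛ-β : (M : Term merged (s ∷ Γ)) (η : Env Γ n) → ∀ C A →
  app (lam (cpsΛ M (liftEnv η) (wkΛ C))) A →w cpsΛ M (η ▸ A) C
cpsΛ-β M η C A = →w-β _ A
  (trans (substΛ-cps (liftEnv η) (η ▸ A) (SubstEnv-single η A) M (wkΛ C))
         (cong (cpsΛ M (η ▸ A)) (subst-single-wk C A)))

cpsΛ-μ : (J : Jump merged (cont ∷ Γ)) (η : Env Γ n) → ∀ C → cpsΛ (μ J) η C →w jumpΛ J (η ▸ C)
cpsΛ-μ J η C = →w-β _ C (substΛ-jump (liftEnv η) (η ▸ C) (SubstEnv-single η C) J)

-- A value in an application frame selects the clause whose administrative redex is already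
-- contracted: one step there, none for `□` or a `where` frame.
ctxΛ-plug-value : ∀ E {U : Term merged Γ} (w : Value U) (η : Env Γ n) → ∀ C →
  ∃[ j ] Steps j (cpsΛ U η (ctxΛ E η C)) (cpsΛ (E ⟦ U ⟧) η C)
ctxΛ-plug-value □ w η C = 0 , done
ctxΛ-plug-value (_[_·□] E {V} v) {U} w η C
  rewrite cpsΛ-plug E {V · U} (λ ()) η C | cpsΛ-value-· v U η (ctxΛ E η C)
        | cpsArg-value w η (starΛ V v η) (ctxΛ E η C)
        | cpsΛ-value w η (ctxΛ (E [ v ·□]) η C) =
  1 , step (→w-β _ _ (cong₂ (λ A B → app (app A _) B)
        (subst-single-wk (starΛ V v η) _) (subst-single-wk (ctxΛ E η C) _))) done
ctxΛ-plug-value (E [□· M ]) {U} w η C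
  rewrite cpsΛ-plug E {U · M} (λ ()) η C | cpsΛ-value-· w M η (ctxΛ E η C)
        | cpsΛ-value w η (ctxΛ (E [□· M ]) η C) =
  1 , step (→w-β _ _ (trans
        (substΛ-arg (wkEnv η) η (λ x → subst-single-wk (η x) _) M (value? M) (var zero)
          (wkΛ (ctxΛ E η C)))
        (cong (cpsArg M (value? M) η _) (subst-single-wk (ctxΛ E η C) _)))) done
ctxΛ-plug-value (E [ M ≔□]) {U} w η C
  rewrite cpsΛ-plug E {M where≔ U} (λ ()) η C = 0 , done

ctxΛ-plug : ∀ E (L : Term merged Γ) (η : Env Γ n) → ∀ C →
  ∃[ j ] Steps j (cpsΛ L η (ctxΛ E η C)) (cpsΛ (E ⟦ L ⟧) η C)
ctxΛ-plug E L η C with value? L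
... | yes v = ctxΛ-plug-value E v η C
... | no ¬v rewrite cpsΛ-plug E ¬v η C = 0 , done

-- Simulation of E-rewriting by weak head reduction

-- Decreases at the steps that do not shorten weak head reduction; bodies of
-- where, λ and μ are not in evaluation position and do not count.
rank : Term merged Γ → ℕ
rank (var x)      = 0
rank (ƛ M)        = 0
rank (M · N)      = 2 + (rank M + rank N)
rank (L where≔ M) = 1 + rank M
rank (μ J)        = 0

rank-plug : ∀ E {L L′ : Term merged Γ} → rank L′ < rank L → rank (E ⟦ L′ ⟧) < rank (E ⟦ L ⟧)
rank-plug □ h = h
rank-plug (_[_·□] E {V} v) h = rank-plug E (s≤s (s≤s (+-monoʳ-< (rank V) h)))
rank-plug (E [□· M ]) h = rank-plug E (s≤s (s≤s (+-monoˡ-< (rank M) h)))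
rank-plug (E [ M ≔□]) h = rank-plug E (s≤s h)

-- A and A′ have a common weak head reduct, nearer to A′ than to A unless P holds.
Sim : Set → Λ n → Λ n → Set
Sim P A A′ = ∃[ i ] ∃[ j ] ∃[ X ]
  (Steps (suc i) A X × Steps j A′ X × (j ≤ i ⊎ (j ≡ suc i × P)))

Sim-plug : ∀ {P} E {L L′ : Term merged Γ} → ¬ Value L → ¬ Value L′ → (η : Env Γ n) → ∀ C →
  Sim P (cpsΛ L η (ctxΛ E η C)) (cpsΛ L′ η (ctxΛ E η C)) →
  Sim P (cpsΛ (E ⟦ L ⟧) η C) (cpsΛ (E ⟦ L′ ⟧) η C)
Sim-plug E ¬v ¬v′ η C h rewrite cpsΛ-plug E ¬v η C | cpsΛ-plug E ¬v′ η C = h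

-- Both sides translate `μ J` at equal continuations. `Sim` demands a step on the left, so the same
-- step is taken on both sides and `P` must provide the decrease.
Sim-μ : ∀ {P : Set} (J : Jump merged (cont ∷ Γ)) (η : Env Γ n) {A A′ : Λ (suc n)} → A ≡ A′ → P →
  Sim P (cpsΛ (μ J) η (lam A)) (cpsΛ (μ J) η (lam A′))
Sim-μ J η {A} refl p = 0 , 1 , _ , step r done , step r done , inj₂ (refl , p)
  where r = cpsΛ-μ J η (lam A)

E₀-sim : {L L′ : Term merged Γ} → L →E₀ L′ → (η : Env Γ n) → ∀ C →
  Sim (rank L′ < rank L) (cpsΛ L η C) (cpsΛ L′ η C)
E₀-sim (μ-fun E J M) η C = Sim-plug E (λ ()) (λ ()) η C
  (Sim-μ J η (sym (cpsArg-agree (wk-agree (wkEnv η) (var zero) M) (value? (wk M)) (value? M) _ _))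
    -- The application has rank at least 2, the `where` replacing it rank 1, since `μ J` has rank 0.
    (rank-plug E (s≤s (s≤s z≤n))))
E₀-sim (μ-arg E {V} v J) η C = Sim-plug E (λ ()) (λ ()) η C sim
  where
  K′ = ctxΛ E η C
  sim : Sim _ (cpsΛ (V · μ J) η K′) (cpsΛ ((wk V · var Z) where≔ μ J) η K′)
  sim rewrite cpsΛ-value-· v (μ J) η K′ | cpsΛ-value-· (wk-value v) (var Z) (liftEnv η) (wkΛ K′) =
    Sim-μ J η (cong (λ A → app (app A (var zero)) (wkΛ K′))
      (sym (trans (Agree-star (wk-agree (wkEnv η) (var zero) V) (wk-value v) v) (starΛ-wkEnv η V v))))
      (rank-plug E {L = V · μ J} (s≤s (s≤s z≤n)))
E₀-sim (β-lam E M {V} v) η C = Sim-plug E (λ ()) (λ ()) η C sim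
  where
  K′ = ctxΛ E η C
  V* = starΛ V v η
  sim : Sim _ (cpsΛ (ƛ M · V) η K′) (cpsΛ (M where≔ V) η K′)
  sim rewrite cpsArg-value v η (starΛ (ƛ M) (ƛ M) η) K′
            | cpsΛ-value v η (lam (cpsΛ M (liftEnv η) (wkΛ K′))) =
    -- On the left the abstraction takes the value and then the continuation; on the right the
    -- continuation is already inside the body, leaving one step.
    1 , 1 , cpsΛ M (η ▸ V*) K′ ,
    step (appˡ (→w-β _ V* (cong lam (substΛ-cps (wkEnv (liftEnv η)) (wkEnv (η ▸ V*))
            (SubstEnv-wk (liftEnv η) (η ▸ V*) (SubstEnv-single η V*)) M (var zero)))))
      (step (→w-β _ K′ (substΛ-cps (wkEnv (η ▸ V*)) (η ▸ V*)
            (λ x → subst-single-wk ((η ▸ V*) x) K′) M (var zero))) done) ,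
    step (cpsΛ-β M η K′ V*) done ,
    inj₁ ≤-refl
E₀-sim (β-val E M {V} v) η C with ctxΛ-plug E (M [ V /x]) η C
-- The `j` extra steps contract the administrative redex that may arise when `M [ V /x]` is a value.
... | j , rs = j , 0 , _ , sim , done , inj₁ z≤n
  where
  K′ = ctxΛ E η C
  sim : Steps (suc j) (cpsΛ (E ⟦ M where≔ V ⟧) η C) (cpsΛ (E ⟦ M [ V /x] ⟧) η C)
  sim rewrite cpsΛ-plug E {M where≔ V} (λ ()) η C
            | cpsΛ-value v η (lam (cpsΛ M (liftEnv η) (wkΛ K′))) =
    step (cpsΛ-β M η K′ (starΛ V v η)) (transport (λ A → Steps j A _) ([/x]-cps v η M K′) rs)
E₀-sim (β-μ E M J) η C = Sim-plug E (λ ()) (λ ()) η C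
  (0 , 1 , _ , step (cpsΛ-μ J η B) done ,
   step (transport (cpsΛ (μ J′) η K′ →w_) J′≡J (cpsΛ-μ J′ η K′)) done ,
   inj₂ (refl , rank-plug E (s≤s z≤n)))
  where
  K′ = ctxΛ E η C
  B  = lam (cpsΛ M (liftEnv η) (wkΛ K′))
  M′ = ren (ext there) M
  J′ = ctxSubJ Z M′ J
  -- The redex binds the variable of the μ to `B`; the contractum binds it to `K′` and stores the
  -- `where` at each jump to it. `CtxEnv` equates the two.
  J′≡J : jumpΛ J′ (η ▸ K′) ≡ jumpΛ J (η ▸ B)
  J′≡J = ctxSubJ-agree Z M′ (η ▸ K′) (η ▸ B) (record
    { ords   = λ { (S x) → refl }
    ; others = λ { Z Z≢Z → contradiction refl Z≢Z ; (S l) _ → refl }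
    ; target = cong lam (cps≡ (ren-agree (ext there) (liftEnv (η ▸ K′)) (liftEnv η)
                 (λ { Z → refl ; (S x) → refl }) M) (wkΛ K′)) }) J

-- Both sides need the same `m` steps from the common reduct, so the counts compare as `suc i` and
-- `j`. With `P` a decrease of rank, the result is a lexicographic decrease.
Sim-Halts : ∀ {P k} {A A′ : Λ n} → Sim P A A′ → Halts k A →
  ∃[ k′ ] (Halts k′ A′ × (k′ < k ⊎ (k′ ≡ k × P)))
Sim-Halts (i , j , X , rs , rs′ , d) h with Halts-reduct rs h
Sim-Halts (i , j , X , rs , rs′ , inj₁ j≤i) h | m , refl , h′ =
  j + m , Halts-expand rs′ h′ , inj₁ (s≤s (+-monoˡ-≤ m j≤i))
Sim-Halts (i , j , X , rs , rs′ , inj₂ (refl , p)) h | m , refl , h′ =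
  suc i + m , Halts-expand rs′ h′ , inj₂ (refl , p)

Sim⇒=β : ∀ {P} {A A′ : Λ n} → Sim P A A′ → A =β A′
Sim⇒=β (_ , _ , _ , rs , rs′ , _) = Steps⇒=β rs ◅◅ Eq.symmetric _ (Steps⇒=β rs′)

[/k]-cps : (J : Jump merged (cont ∷ Γ)) (l : cont ∈ Γ) (η : Env Γ n) →
  jumpΛ (J [ l /k]) η ≡ jumpΛ J (η ▸ η l)
[/k]-cps J l η = renJ-agree _ η (η ▸ η l) (λ { Z → refl ; (S x) → refl }) J

-- Solvability only needs conversion, so the step counts are dropped. For `μμ`, both sides reach `J`
-- with its two newest variables bound to `C` and to the continuation of `l`.
→E⇒=β : {L L′ : Term merged Γ} → L →E L′ → (η : Env Γ n) → ∀ C → cpsΛ L η C =β cpsΛ L′ η C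
→E⇒=β (μμ l J) η C =
  Steps⇒=β (step (cpsΛ-μ ([ l ] μ J) η C) (step (cpsΛ-μ J (η ▸ C) _) done)) ◅◅
  Eq.symmetric _ (Steps⇒=β (step
    (transport (cpsΛ (μ (J [ l /k])) η C →w_) ([/k]-cps J l (η ▸ C)) (cpsΛ-μ (J [ l /k]) η C)) done))
→E⇒=β (top r) η C = Sim⇒=β (E₀-sim r η C)
→E⇒=β (jump l {L} {L′} r) η C =
  Steps⇒=β (step (cpsΛ-μ ([ l ] L) η C) done) ◅◅
  Sim⇒=β (E₀-sim r (η ▸ C) _) ◅◅
  Eq.symmetric _ (Steps⇒=β (step (cpsΛ-μ ([ l ] L′) η C) done))

→E*⇒=β : {L L′ : Term merged Γ} → L →E* L′ → (η : Env Γ n) → ∀ C → cpsΛ L η C =β cpsΛ L′ η C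
→E*⇒=β ε        η C = ε
→E*⇒=β (r ◅ rs) η C = →E⇒=β r η C ◅◅ →E*⇒=β rs η C

-- Normal forms

data Inert {Γ} : Term merged Γ → Set where
  value : ∀ {V} → Value V → Inert V
  stuck : ∀ E x {V} → Value V → Inert (E ⟦ var x · V ⟧)

-- Values and μ-abstractions are reported without a verdict, because whether they complete a redex
-- depends on the innermost frame of `E`.
data Progress {Γ} (E : EvalCtx Γ) : Term merged Γ → Set where
  value   : ∀ {V} → Value V → Progress E V
  mu      : ∀ J → Progress E (μ J)
  reduces : ∀ {L N} → E ⟦ L ⟧ →E₀ N → Progress E L
  stuck   : ∀ {L} → Inert (E ⟦ L ⟧) → Progress E L

progress : ∀ E (L : Term merged Γ) → Progress E L
progress E (var x) = value (var x)
progress E (ƛ M)   = value (ƛ M)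
progress E (μ J)   = mu J
progress E (L where≔ M) with progress (E [ L ≔□]) M
... | value v   = reduces (β-val E L v)
... | mu J      = reduces (β-μ E L J)
... | reduces r = reduces r
... | stuck i   = stuck i
progress E (M · N) with progress (E [□· N ]) M
... | mu J      = reduces (μ-fun E J N)
... | reduces r = reduces r
... | stuck i   = stuck i
... | value v with progress (E [ v ·□]) N
... | mu J      = reduces (μ-arg E v J)
... | reduces r = reduces r
... | stuck i   = stuck i
progress E (M · N) | value (var x) | value w = stuck (stuck E x w)
progress E (M · N) | value (ƛ L)   | value w = reduces (β-lam E L w)

data Outcome {Γ} : Term merged Γ → Set where
  inert   : ∀ {L} → Inert L → Outcome L
  mu      : ∀ J → Outcome (μ J)
  reduces : ∀ {L N} → L →E₀ N → Outcome L

outcome : (L : Term merged Γ) → Outcome L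
outcome L with progress □ L
... | value v   = inert (value v)
... | mu J      = mu J
... | reduces r = reduces r
... | stuck i   = inert i

Inert-VarHeaded : {L : Term merged Γ} → Inert L → (η : Env Γ n) →
  (∀ {s} (x : s ∈ Γ) → VarHeaded (η x)) → ∀ {C} → VarHeaded C → VarHeaded (cpsΛ L η C)
Inert-VarHeaded (value v) η h {C} c = transport VarHeaded (sym (cpsΛ-value v η C)) (app c _)
Inert-VarHeaded (stuck E x {V} v) η h {C} c
  rewrite cpsΛ-plug E {var x · V} (λ ()) η C | cpsArg-value v η (η x) (ctxΛ E η C) =
  app (app (h x) _) _

-- Sending all variables and the continuation to one target variable makes the translation
-- variable-headed, hence normal. Terms whose translations always reduce are thus excluded without
-- inspecting contexts.
Inert-¬→w : {L : Term merged Γ} → Inert L →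
  ¬ (∀ (η : Env Γ 1) C → ∃[ B ] cpsΛ L η C →w B)
Inert-¬→w i f = VarHeaded-normal
  (Inert-VarHeaded i (λ _ → var zero) (λ _ → var zero) (var zero))
  (proj₂ (f (λ _ → var zero) (var zero)))

Inert-¬E₀ : {L N : Term merged Γ} → Inert L → ¬ (L →E₀ N)
Inert-¬E₀ i r = Inert-¬→w i λ η C → reduct (E₀-sim r η C)
  where
  reduct : ∀ {P} {A A′ : Λ n} → Sim P A A′ → ∃[ B ] A →w B
  reduct (_ , _ , _ , step r _ , _) = _ , r

Inert-¬μ : ∀ {J : Jump merged (cont ∷ Γ)} → ¬ Inert (μ J)
Inert-¬μ {J = J} i = Inert-¬→w i λ η C → _ , cpsΛ-μ J η C

plug-≢μ : ∀ E {L : Term merged Γ} → (∀ {J} → L ≢ μ J) → ∀ {J} → E ⟦ L ⟧ ≢ μ J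
plug-≢μ □            h = h
plug-≢μ (E [ v ·□])  h = plug-≢μ E (λ ())
plug-≢μ (E [□· M ])  h = plug-≢μ E (λ ())
plug-≢μ (E [ M ≔□])  h = plug-≢μ E (λ ())

E₀-≢μ : {L N : Term merged Γ} → L →E₀ N → ∀ {J} → L ≢ μ J
E₀-≢μ (μ-fun E J M) = plug-≢μ E (λ ())
E₀-≢μ (μ-arg E v J) = plug-≢μ E (λ ())
E₀-≢μ (β-lam E M v) = plug-≢μ E (λ ())
E₀-≢μ (β-val E M v) = plug-≢μ E (λ ())
E₀-≢μ (β-μ E M J)   = plug-≢μ E (λ ())

Inert-ENormal : {L : Term merged Γ} → Inert L → ENormal L
Inert-ENormal i (_ , μμ l J)   = Inert-¬μ i
Inert-ENormal i (_ , top r)    = Inert-¬E₀ i r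
Inert-ENormal i (_ , jump l r) = Inert-¬μ i

Inert-jump-ENormal : ∀ l {L : Term merged (cont ∷ Γ)} → Inert L → ENormal (μ ([ l ] L))
Inert-jump-ENormal l i (_ , μμ .l J)   = Inert-¬μ i
Inert-jump-ENormal l i (_ , top r)     = E₀-≢μ r refl
Inert-jump-ENormal l i (_ , jump .l r) = Inert-¬E₀ i r

-- Normality leaves an inert term, or `μ ([ l ] L)` with `L` inert; in the second case one weak head
-- step feeds `C` to the μ.
ENormal-VarHeaded : {N : Term merged Γ} → ENormal N → (η : Env Γ n) →
  (∀ {s} (x : s ∈ Γ) → VarHeaded (η x)) → ∀ {C} → VarHeaded C →
  ∃[ B ] (cpsΛ N η C =β B × VarHeaded B)
ENormal-VarHeaded {N = N} nf η h {C} c with outcome N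
... | inert i   = _ , ε , Inert-VarHeaded i η h c
... | reduces r = contradiction (_ , top r) nf
... | mu ([ l ] L) with outcome L
... | reduces r = contradiction (_ , jump l r) nf
... | mu J      = contradiction (_ , μμ l J) nf
... | inert i   = _ , Steps⇒=β (step (cpsΛ-μ ([ l ] L) η C) done) ,
  Inert-VarHeaded i (η ▸ C) h′ (h′ l)
  where
  h′ : ∀ {s} (x : s ∈ (cont ∷ _)) → VarHeaded ((η ▸ C) x)
  h′ Z     = c
  h′ (S x) = h x

-- Evaluation driven by weak head reduction

Evaluates : Term merged Γ → Set
Evaluates M = ∃[ N ] (M →E* N × ENormal N)

infixr 5 _◅ᵉ_
_◅ᵉ_ : {M N : Term merged Γ} → M →E N → Evaluates N → Evaluates M
r ◅ᵉ (N , rs , nf) = N , r ◅ rs , nf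

Halts-step : ∀ {k} {A B : Λ n} → A →w B → Halts k A → ∃[ m ] (m < k × Halts m B)
Halts-step r h with Halts-reduct (step r done) h
... | m , refl , h′ = m , n<1+n m , h′

_<ₗₑₓ_ : ℕ × ℕ → ℕ × ℕ → Set
_<ₗₑₓ_ = ×-Lex _≡_ _<_ _<_

<ₗₑₓ-wellFounded : WellFounded _<ₗₑₓ_
<ₗₑₓ-wellFounded = ×-wellFounded <-wellFounded <-wellFounded

-- The recursion is on the halting count, then the rank. `η` already binds the variable of the
-- surrounding μ, so only `L` at the continuation `η l` is tracked; an inner μ costs one weak head
-- step and is absorbed by `μμ`.
evaluate-jump : ∀ {k} (L : Term merged (cont ∷ Γ)) → Acc _<ₗₑₓ_ (k , rank L) →
  ∀ l (η : Env (cont ∷ Γ) n) → Halts k (cpsΛ L η (η l)) → Evaluates (μ ([ l ] L))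
evaluate-jump L (acc rs) l η h with outcome L
... | inert i = _ , ε , Inert-jump-ENormal l i
... | reduces {N = N} r with Sim-Halts (E₀-sim r η (η l)) h
...   | _ , h′ , d = jump l r ◅ᵉ evaluate-jump N (rs d) l η h′
evaluate-jump _ (acc rs) l η h | mu J@([ m ] L) with Halts-step (cpsΛ-μ J η (η l)) h
... | k , k<k₀ , h′ = μμ l J ◅ᵉ
  evaluate-jump _ (rs (inj₁ k<k₀)) _ η (transport (Halts k) (sym ([/k]-cps J l η)) h′)

-- A μ at the top binds its variable to `C` in one weak head step; all further rewriting is left to
-- `evaluate-jump`.
evaluate : ∀ {k} (L : Term merged Γ) → Acc _<ₗₑₓ_ (k , rank L) →
  ∀ (η : Env Γ n) C → Halts k (cpsΛ L η C) → Evaluates L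
evaluate L (acc rs) η C h with outcome L
... | inert i = _ , ε , Inert-ENormal i
... | reduces {N = N} r with Sim-Halts (E₀-sim r η C) h
...   | _ , h′ , d = top r ◅ᵉ evaluate N (rs d) η C h′
evaluate _ (acc rs) η C h | mu J@([ l ] L) with Halts-step (cpsΛ-μ J η C) h
... | k , k<k₀ , h′ = evaluate-jump L (rs (inj₁ k<k₀)) l (η ▸ C) h′

erase-CPS : (M : Term full Γ) →
  erase CPS⟦ M ⟧ ≡ lam (cpsΛ (merge M) (λ x → var (suc (index x))) (var zero))
erase-CPS M = cong lam (erase-cps there _ (λ _ → refl) M (kvar Z))

theorem2p31 : ∀ {Γ : Ctx} (M : Term full Γ) → Terminates M ⇔ Solvable (erase CPS⟦ M ⟧)
theorem2p31 {Γ} M rewrite erase-CPS M = mk⇔ to from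
  where
  η : Env Γ (suc (length Γ))
  -- Index `zero` is the continuation variable bound by the outermost λ.
  η x = var (suc (index x))

  to : Terminates M → Solvable (lam (cpsΛ (merge M) η (var zero)))
  to (N , rs , nf) with ENormal-VarHeaded nf η (λ _ → var _) (var zero)
  ... | B , N=B , h =
    lam B , Eq.gmap lam lam (→E*⇒=β rs η (var zero) ◅◅ N=B) , lam (head h)

  from : Solvable (lam (cpsΛ (merge M) η (var zero))) → Terminates M
  from sol with SN⇒Halts (solvable⇒SN sol)
  ... | _ , h = evaluate (merge M) (<ₗₑₓ-wellFounded _) η (var zero) h
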